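{- Let $k\ge2$ be an integer and let $H$ be a finite graph that admits a proper $k$-coloring (in particular $H$ has no loops). Then $\hom(\mathbb{T}^{k-1},H)$ has long range action.
   Context: A proper $k$-coloring of $H$ is a map from its nodes to a $k$-element set assigning distinct colors to adjacent nodes. $\mathbb{T}^r$ is the infinite connected cycle-free graph with all degrees $r+1$, with a fixed root site $x$; $\hom(\mathbb{T}^r,H)$ is the set of graph homomorphisms $\mathbb{T}^r\to H$. $\hom(\mathbb{T}^r,H)$ has long range action if there exist $\varphi\in\hom(\mathbb{T}^r,H)$ and a node $i$ of $H$ such that for every $n\ge1$, no $\psi\in\hom(\mathbb{T}^r,H)$ which agrees with $\varphi$ on all sites at distance $n$ from $x$ satisfies $\psi(x)=i$.
   Formalization: The graph H is additionally assumed to have at least one edge; for an edgeless H (for example a single node) there are no homomorphisms from the tree to H, so long range action, which asks for one, fails. -}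

module Defs where

open import Level using (0ℓ)
open import Data.Nat using (ℕ; zero; suc; _+_; _≤_; _<_; s≤s)
open import Data.Nat.Properties using (+-suc; +-identityʳ; m≤m+n; <-irrefl)
open import Data.Fin using (Fin; zero; suc)
open import Data.List using (List; []; _∷_; length; replicate)
open import Data.List.Properties using (length-replicate)
open import Data.Product using (Σ-syntax; ∃; ∃-syntax; ∃₂; _×_; _,_; proj₁; proj₂)
open import Data.Sum using (_⊎_; inj₁; inj₂; swap)
open import Data.Empty using (⊥-elim)
open import Function using (Injective)
open import Relation.Nullary using (¬_)
open import Relation.Binary using (Rel; Symmetric; Decidable)
open import Relation.Binary.PropositionalEquality using (_≡_; _≢_; refl; sym; trans; cong)

-- Undirected graphs without multiple edges; loops are allowed.
record Graph : Set₁ where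
  infix 4 _~_
  field
    Vertex : Set
    _~_    : Rel Vertex 0ℓ
    ~-sym  : Symmetric _~_

-- Adjacency in a finite graph is required to be decidable, so that "finite
-- graph" has its usual meaning constructively.
record FiniteGraph : Set₁ where
  infix 4 _~_
  field
    order : ℕ
    _~_   : Rel (Fin order) 0ℓ
    ~-sym : Symmetric _~_
    _~?_  : Decidable _~_

  graph : Graph
  graph = record { Vertex = Fin order ; _~_ = _~_ ; ~-sym = ~-sym }

  -- Exactly the condition for hom(𝕋ʳ, H) to be inhabited; an edgeless graph
  -- therefore never has long range action.
  HasEdge : Set
  HasEdge = ∃₂ λ u v → u ~ v

record Hom (G H : Graph) : Set where
  private
    module G = Graph G
    module H = Graph H
  field
    map       : G.Vertex → H.Vertex
    preserves : ∀ {u v} → u G.~ v → map u H.~ map v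

record ProperColoring (k : ℕ) (G : Graph) : Set where
  open Graph G
  field
    color  : Vertex → Fin k
    proper : ∀ {u v} → u ~ v → color u ≢ color v

module _ (G : Graph) where
  open Graph G

  data Walk : Vertex → Vertex → ℕ → Set where
    []  : ∀ {u} → Walk u u 0
    _∷_ : ∀ {u v w n} → u ~ v → Walk v w n → Walk u w (suc n)

  AtDistance : ℕ → Vertex → Vertex → Set
  AtDistance n u v = Walk u v n × (∀ m → Walk u v m → n ≤ m)

LongRangeAction : (T : Graph) → Graph.Vertex T → Graph → Set
LongRangeAction T x H =
  Σ[ φ ∈ Hom T H ] Σ[ i ∈ Graph.Vertex H ]
    (∀ n → 1 ≤ n →
      ¬ (Σ[ ψ ∈ Hom T H ]
           (∀ s → AtDistance T n x s → Hom.map ψ s ≡ Hom.map φ s)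
           × Hom.map ψ x ≡ i))

-- The sites of 𝕋ʳ: the root has r + 1 children and every other site has r.
-- `branch a p` is reached from the root through its child a, and then by
-- following p; the last step taken is the head of p.
data Site (r : ℕ) : Set where
  root   : Site r
  branch : Fin (suc r) → List (Fin r) → Site r

-- u ⋖ v: u is the parent of v.
infix 4 _⋖_
data _⋖_ {r : ℕ} : Rel (Site r) 0ℓ where
  top  : ∀ {a} → root ⋖ branch a []
  down : ∀ {a b p} → branch a p ⋖ branch a (b ∷ p)

𝕋 : ℕ → Graph
𝕋 r = record
  { Vertex = Site r
  ; _~_    = λ u v → u ⋖ v ⊎ v ⋖ u
  ; ~-sym  = swap
  }

-- The remainder verifies that, for r ≥ 1, 𝕋 r is the infinite connected
-- cycle-free graph with all degrees r + 1.

-- Cycles are periodic non-backtracking sequences.  Every simple cycle of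
-- length at least 3 gives one, and a graph without simple cycles has none.
record Cycle (G : Graph) : Set where
  open Graph G
  field
    at              : ℕ → Vertex
    period          : ℕ
    positive        : 1 ≤ period
    periodic        : ∀ i → at (i + period) ≡ at i
    adjacent        : ∀ i → at i ~ at (suc i)
    nonBacktracking : ∀ i → at i ≢ at (suc (suc i))

record IsRegularTree (d : ℕ) (G : Graph) : Set where
  open Graph G
  field
    infinite  : Σ[ f ∈ (ℕ → Vertex) ] Injective _≡_ _≡_ f
    connected : ∀ u v → ∃ (Walk G u v)
    cycleFree : ¬ Cycle G
    regular   : ∀ v → Σ[ f ∈ (Fin d → Vertex) ]
                  Injective _≡_ _≡_ f
                  × (∀ j → v ~ f j)
                  × (∀ w → v ~ w → ∃[ j ] f j ≡ w)

module _ {r : ℕ} where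
  open Graph (𝕋 r) using (_~_; ~-sym)

  private
    depth : Site r → ℕ
    depth root         = 0
    depth (branch _ p) = suc (length p)

    depth-⋖ : ∀ {u v : Site r} → u ⋖ v → depth v ≡ suc (depth u)
    depth-⋖ top  = refl
    depth-⋖ down = refl

    parent-unique : ∀ {u v w : Site r} → u ⋖ w → v ⋖ w → u ≡ v
    parent-unique top  top  = refl
    parent-unique down down = refl

    _++ʷ_ : ∀ {u v w m n} → Walk (𝕋 r) u v m → Walk (𝕋 r) v w n → Walk (𝕋 r) u w (m + n)
    []      ++ʷ q = q
    (e ∷ p) ++ʷ q = e ∷ (p ++ʷ q)

    fromRoot : ∀ v → ∃ (Walk (𝕋 r) root v)
    fromRoot root               = 0 , []
    fromRoot (branch a [])      = 1 , inj₁ top ∷ []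
    fromRoot (branch a (b ∷ p)) = _ , proj₂ (fromRoot (branch a p)) ++ʷ (inj₁ down ∷ [])

    toRoot : ∀ v → ∃ (Walk (𝕋 r) v root)
    toRoot root               = 0 , []
    toRoot (branch a [])      = 1 , inj₂ top ∷ []
    toRoot (branch a (b ∷ p)) = _ , inj₂ down ∷ proj₂ (toRoot (branch a p))

  𝕋-connected : ∀ u v → ∃ (Walk (𝕋 r) u v)
  𝕋-connected u v = _ , proj₂ (toRoot u) ++ʷ proj₂ (fromRoot v)

  𝕋-cycleFree : ¬ Cycle (𝕋 r)
  𝕋-cycleFree c = noDown 0 down₀
    where
    open Cycle c

    Down : ℕ → Set
    Down i = at i ⋖ at (suc i)

    step : ∀ i → Down i → Down (suc i)
    step i d with adjacent (suc i)
    ... | inj₁ d′ = d′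
    ... | inj₂ u  = ⊥-elim (nonBacktracking i (parent-unique d u))

    descend : ∀ n i → Down i → Down (i + n) × depth (at (i + n)) ≡ depth (at i) + n
    descend zero i d rewrite +-identityʳ i | +-identityʳ (depth (at i)) = d , refl
    descend (suc n) i d with descend n i d
    ... | dₙ , eq rewrite +-suc i n | +-suc (depth (at i)) n =
      step (i + n) dₙ , trans (depth-⋖ dₙ) (cong suc eq)

    grows : ∀ {a n} → 1 ≤ n → a < a + n
    grows {a} {suc n} _ rewrite +-suc a n = s≤s (m≤m+n a n)

    noDown : ∀ i → ¬ Down i
    noDown i d = <-irrefl
      (trans (sym (cong depth (periodic i))) (proj₂ (descend period i d)))
      (grows positive)

    up : ∀ i → at (suc i) ⋖ at i
    up i with adjacent i
    ... | inj₁ d = ⊥-elim (noDown i d)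
    ... | inj₂ u = u

    ascend : ∀ n → depth (at n) + n ≡ depth (at 0)
    ascend zero = +-identityʳ _
    ascend (suc n) =
      trans (+-suc _ n) (trans (cong (_+ n) (sym (depth-⋖ (up n)))) (ascend n))

    down₀ : Down 0
    down₀ = ⊥-elim (<-irrefl
      (trans (cong depth (periodic 0)) (sym (ascend period)))
      (grows positive))

  𝕋-regular : ∀ v → Σ[ f ∈ (Fin (suc r) → Site r) ]
                Injective _≡_ _≡_ f
                × (∀ j → v ~ f j)
                × (∀ w → v ~ w → ∃[ j ] f j ≡ w)
  𝕋-regular root = (λ j → branch j []) , (λ { refl → refl }) , (λ _ → inj₁ top)
    , λ { _ (inj₁ (top {a})) → a , refl }
  𝕋-regular (branch a []) = f , inj , adj , onto
    where
    f : Fin (suc r) → Site r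
    f zero    = root
    f (suc b) = branch a (b ∷ [])

    inj : Injective _≡_ _≡_ f
    inj {zero}  {zero}  _    = refl
    inj {suc _} {suc _} refl = refl

    adj : ∀ j → branch a [] ~ f j
    adj zero    = inj₂ top
    adj (suc b) = inj₁ down

    onto : ∀ w → branch a [] ~ w → ∃[ j ] f j ≡ w
    onto _ (inj₁ (down {b = b})) = suc b , refl
    onto _ (inj₂ top)            = zero , refl
  𝕋-regular (branch a (c ∷ p)) = f , inj , adj , onto
    where
    f : Fin (suc r) → Site r
    f zero    = branch a p
    f (suc b) = branch a (b ∷ c ∷ p)

    inj : Injective _≡_ _≡_ f
    inj {zero}  {zero}  _    = refl
    inj {zero}  {suc _} ()
    inj {suc _} {zero}  ()
    inj {suc _} {suc _} refl = refl

    adj : ∀ j → branch a (c ∷ p) ~ f j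
    adj zero    = inj₂ down
    adj (suc b) = inj₁ down

    onto : ∀ w → branch a (c ∷ p) ~ w → ∃[ j ] f j ≡ w
    onto _ (inj₁ (down {b = b})) = suc b , refl
    onto _ (inj₂ down)           = zero , refl

𝕋-isRegularTree : ∀ r → 1 ≤ r → IsRegularTree (suc r) (𝕋 r)
𝕋-isRegularTree (suc r) _ = record
  { infinite  = ray , λ {m} {n} eq →
      trans (sym (length-replicate m)) (trans (cong size eq) (length-replicate n))
  ; connected = 𝕋-connected
  ; cycleFree = 𝕋-cycleFree
  ; regular   = 𝕋-regular
  }
  where
  ray : ℕ → Site (suc r)
  ray n = branch zero (replicate n zero)

  size : Site (suc r) → ℕ
  size root         = 0
  size (branch _ p) = length p

{-# OPTIONS --safe #-}
module Submission where

-- Place the nodes of H in ℚ^(k-1) so that adjacent nodes have inner product at most -1; the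
-- colouring gives one such placement, with the vertices of a simplex.  Consider a placement
-- whose largest squared norm B is almost minimal.  A node u of almost maximal norm cannot be
-- shortened, so by Helly's theorem there are already k-1 neighbours of u, themselves of almost
-- maximal norm, such that the points of the ball of radius √B making inner product at most -1
-- with all of them lie close to u: otherwise a midpoint would be shorter.  Hence, whenever
-- these k-1 neighbours are replaced by nodes placed close to them, every common neighbour of
-- the replacements is placed close to u.  Iterating this along the tree, boundary values at any
-- depth force the value at the root to be placed close to u, which excludes the neighbours of u.
-- Closeness does not deteriorate along the tree because the threshold is chosen such that no
-- two nodes have a distance slightly above it.

open import Algebra.Bundles using (CommutativeRing)
open import Data.Fin using (Fin; zero; suc; toℕ; fromℕ<; inject≤; punchIn; punchOut; combine; remQuot)
open import Data.Fin.Properties as Fin using (all?; any?; ¬∀⟶∃¬; pigeonhole; punchIn-punchOut; remQuot-combine; toℕ-inject≤; toℕ<n; toℕ≤pred[n])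
open import Data.Fin.Subset using (Subset; _∈_; _∉_; ∣_∣; ⊤) renaming (_-_ to _∖_)
open import Data.Fin.Subset.Properties using (_∈?_; ∈⊤; nonempty?; x∈p∧x≢y⇒x∈p-y; x∈p⇒∣p-x∣<∣p∣; ∣p∣≤n)
open import Data.Integer as ℤ using (-[1+_])
import Data.Integer.Properties as ℤ
open import Data.List using ([]; _∷_; length)
open import Data.Maybe using (Maybe; just; nothing)
open import Data.Nat as ℕ using (ℕ; zero; suc)
import Data.Nat.Properties as ℕ
open import Data.Product using (Σ-syntax; ∃; ∃₂; ∃-syntax; _×_; _,_; proj₁; proj₂; uncurry)
open import Data.Rational using (ℚ; mkℚ; toℚᵘ; 0ℚ; 1ℚ; ½; _+_; _*_; _-_; -_; _≤_; _<_; _⊔_; 1/_; positive; nonNegative; ≢-nonZero)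
open import Data.Rational.Properties
import Data.Rational.Unnormalised as ℚᵘ
import Data.Rational.Unnormalised.Properties as ℚᵘ
open import Data.Sum using (_⊎_; inj₁; inj₂; [_,_]′)
open import Data.Vec using (Vec; []; _∷_; lookup; tabulate)
open import Data.Vec.Functional using (insertAt)
open import Data.Vec.Functional.Properties using (insertAt-lookup; insertAt-punchIn)
open import Data.Vec.Properties using (lookup∘tabulate)
open import Function using (_∘_)
open import Level using (0ℓ)
open import Relation.Binary using (tri<; tri≈; tri>)
open import Relation.Binary.PropositionalEquality
open import Relation.Nullary using (¬_; Dec; yes; no; contradiction; map′; _×-dec_; _⊎-dec_; _→-dec_)
open import Relation.Nullary.Decidable using (decidable-stable)
open import Tactic.RingSolver using (solve-∀)
open import Tactic.RingSolver.Core.AlmostCommutativeRing using (AlmostCommutativeRing; fromCommutativeRing)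
open import Algebra.Properties.Monoid.Mult +-0-monoid using () renaming (_×_ to _·_)
open import Algebra.Properties.Semiring.Sum (CommutativeRing.semiring +-*-commutativeRing)
  using (sum; sum-cong-≗; sum-remove; ∑-distrib-+; ∑-comm; *-distribˡ-sum; *-distribʳ-sum)
open import Defs

private variable
  d m n : ℕ
  p q : ℚ

-- Linear algebra and Helly's theorem over ℚ

ℚ-ring : AlmostCommutativeRing 0ℓ 0ℓ
ℚ-ring = fromCommutativeRing +-*-commutativeRing isZero
  where
  isZero : ∀ p → Maybe (0ℚ ≡ p)
  isZero p with 0ℚ ≟ p
  ... | yes eq = just eq
  ... | no  _  = nothing

-- Inequalities below are proved by writing `q - p` as a visibly nonnegative `e`; the functions
-- named `certificate` leave the identity to the ring solver.
by-slack : ∀ e → 0ℚ ≤ e → q ≡ p + e → p ≤ q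
by-slack {p = p} e 0≤e refl = subst (_≤ p + e) (+-identityʳ p) (+-monoʳ-≤ p 0≤e)

slack : p ≤ q → 0ℚ ≤ q - p
slack {p} {q} p≤q = subst (_≤ q - p) (+-inverseʳ p) (+-monoˡ-≤ (- p) p≤q)

+-nonNeg : 0ℚ ≤ p → 0ℚ ≤ q → 0ℚ ≤ p + q
+-nonNeg = +-mono-≤

*-nonNeg : 0ℚ ≤ p → 0ℚ ≤ q → 0ℚ ≤ p * q
*-nonNeg {p} {q} 0≤p 0≤q =
  subst (_≤ p * q) (*-zeroʳ p) (*-monoˡ-≤-nonNeg p {{nonNegative 0≤p}} 0≤q)

*-pos : 0ℚ < p → 0ℚ < q → 0ℚ < p * q
*-pos {p} {q} 0<p 0<q =
  subst (_< p * q) (*-zeroʳ p) (*-monoʳ-<-pos p {{positive 0<p}} 0<q)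

square-nonNeg : ∀ p → 0ℚ ≤ p * p
square-nonNeg p with ≤-total 0ℚ p
... | inj₁ 0≤p = *-nonNeg 0≤p 0≤p
... | inj₂ p≤0 = subst (0ℚ ≤_) (neg² p) (*-nonNeg 0≤-p 0≤-p)
  where
  0≤-p : 0ℚ ≤ - p
  0≤-p = neg-antimono-≤ p≤0
  neg² : ∀ p → - p * - p ≡ p * p
  neg² = solve-∀ ℚ-ring

sum-nonNeg : (f : Fin n → ℚ) → (∀ i → 0ℚ ≤ f i) → 0ℚ ≤ sum f
sum-nonNeg {zero}  f 0≤f = ≤-refl
sum-nonNeg {suc n} f 0≤f = +-nonNeg (0≤f zero) (sum-nonNeg (f ∘ suc) (0≤f ∘ suc))

sum-mono : (f g : Fin n → ℚ) → (∀ i → f i ≤ g i) → sum f ≤ sum g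
sum-mono {zero}  f g f≤g = ≤-refl
sum-mono {suc n} f g f≤g = +-mono-≤ (f≤g zero) (sum-mono (f ∘ suc) (g ∘ suc) (f≤g ∘ suc))

term≤sum : (f : Fin n → ℚ) → (∀ i → 0ℚ ≤ f i) → ∀ i → f i ≤ sum f
term≤sum {suc n} f 0≤f i = by-slack (sum (f ∘ punchIn i))
  (sum-nonNeg (f ∘ punchIn i) (0≤f ∘ punchIn i)) (sum-remove {i = i} f)

sum-zero : (f : Fin n → ℚ) → (∀ i → f i ≡ 0ℚ) → sum f ≡ 0ℚ
sum-zero {zero}  f f≡0 = refl
sum-zero {suc n} f f≡0 = cong₂ _+_ (f≡0 zero) (sum-zero (f ∘ suc) (f≡0 ∘ suc))

-- Linear dependence

ℚ^ : ℕ → Set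
ℚ^ d = Fin d → ℚ

combination : (Fin m → ℚ) → (Fin m → ℚ^ d) → ℚ^ d
combination c v j = sum λ i → c i * v i j

-- Gaussian elimination on the first coordinate: if it vanishes throughout it is dropped, otherwise
-- a pivot clears it from the other vectors and a dependency among these lifts back.
linearlyDependent : ∀ d {m} → d ℕ.< m → (v : Fin m → ℚ^ d) →
  Σ[ c ∈ (Fin m → ℚ) ] (∃[ i ] c i ≢ 0ℚ) × (∀ j → combination c v j ≡ 0ℚ)
linearlyDependent zero {suc m} _ v = (λ _ → 1ℚ) , (zero , 1≢0) , λ ()
linearlyDependent (suc d) {suc m} (ℕ.s≤s d<m) v with all? (λ i → v i zero ≟ 0ℚ)
... | yes v₀≡0 with linearlyDependent d (ℕ.m≤n⇒m≤1+n d<m) (λ i → v i ∘ suc)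
...   | c , c≢0 , eqs = c , c≢0 , λ
        { zero    → sum-zero _ λ i → trans (cong (c i *_) (v₀≡0 i)) (*-zeroʳ (c i))
        ; (suc j) → eqs j }
linearlyDependent (suc d) {suc m} (ℕ.s≤s d<m) v | no ¬v₀≡0 = c , (punchIn i₀ l , c≢0) , eqs
  where
  pivot : ∃[ i ] v i zero ≢ 0ℚ
  pivot = ¬∀⟶∃¬ _ _ (λ i → v i zero ≟ 0ℚ) ¬v₀≡0
  i₀ = proj₁ pivot
  a  = v i₀ zero
  b : Fin m → ℚ
  b i = v (punchIn i₀ i) zero
  reduced : Fin m → ℚ^ (suc d)
  reduced i j = a * v (punchIn i₀ i) j - b i * v i₀ j
  IH = linearlyDependent d d<m (λ i → reduced i ∘ suc)
  c′ = proj₁ IH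
  l  = proj₁ (proj₁ (proj₂ IH))
  -- The coefficient of the pivot collects what was subtracted from the other vectors.
  k₀ = - sum (λ i → c′ i * b i)
  c : Fin (suc m) → ℚ
  c = insertAt (λ i → c′ i * a) i₀ k₀

  c≢0 : c (punchIn i₀ l) ≢ 0ℚ
  c≢0 eq = proj₂ (proj₁ (proj₂ IH)) (zeroProduct (trans (sym (insertAt-punchIn _ i₀ k₀ l)) eq))
    where
    zeroProduct : c′ l * a ≡ 0ℚ → c′ l ≡ 0ℚ
    zeroProduct eq = begin
      c′ l               ≡⟨ *-identityʳ _ ⟨
      c′ l * 1ℚ          ≡⟨ cong (c′ l *_) (*-inverseʳ a {{nz}}) ⟨
      c′ l * (a * a⁻¹)   ≡⟨ *-assoc (c′ l) a a⁻¹ ⟨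
      c′ l * a * a⁻¹     ≡⟨ cong (_* a⁻¹) eq ⟩
      0ℚ * a⁻¹           ≡⟨ *-zeroˡ a⁻¹ ⟩
      0ℚ                 ∎
      where
      open ≡-Reasoning
      nz = ≢-nonZero (proj₂ pivot)
      a⁻¹ = (1/ a) {{nz}}

  split : ∀ j → combination c v j ≡ combination c′ reduced j
  split j = begin
    combination c v j
      ≡⟨ sum-remove {i = i₀} (λ i → c i * v i j) ⟩
    c i₀ * y + sum (λ i → c (punchIn i₀ i) * v (punchIn i₀ i) j)
      ≡⟨ cong₂ (λ s t → s * y + t) (insertAt-lookup _ i₀ k₀)
           (sum-cong-≗ λ i → cong (_* v (punchIn i₀ i) j) (insertAt-punchIn _ i₀ k₀ i)) ⟩
    k₀ * y + sum f
      ≡⟨ flip-sign (sum g) y (sum f) ⟩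
    sum f + sum g * - y
      ≡⟨ cong (sum f +_) (*-distribʳ-sum (- y) g) ⟩
    sum f + sum (λ i → g i * - y)
      ≡⟨ ∑-distrib-+ f (λ i → g i * - y) ⟨
    sum (λ i → f i + g i * - y)
      ≡⟨ sum-cong-≗ (λ i → regroup (c′ i) a (v (punchIn i₀ i) j) (b i) y) ⟩
    combination c′ reduced j ∎
    where
    open ≡-Reasoning
    y = v i₀ j
    f g : Fin m → ℚ
    f i = c′ i * a * v (punchIn i₀ i) j
    g i = c′ i * b i
    flip-sign : ∀ s y t → - s * y + t ≡ t + s * - y
    flip-sign = solve-∀ ℚ-ring
    regroup : ∀ c a x b y → c * a * x + c * b * - y ≡ c * (a * x - b * y)
    regroup = solve-∀ ℚ-ring

  eqs : ∀ j → combination c v j ≡ 0ℚ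
  eqs zero    = trans (split zero) (sum-zero _ λ i → vanish (c′ i) a (b i))
    where
    vanish : ∀ c a b → c * (a * b - b * a) ≡ 0ℚ
    vanish = solve-∀ ℚ-ring
  eqs (suc j) = trans (split (suc j)) (proj₂ (proj₂ IH) j)

-- Convexity and the theorems of Radon and Helly

infix 4 _IsConvexCombinationOf_
record _IsConvexCombinationOf_ (x : ℚ^ d) (v : Fin m → ℚ^ d) : Set where
  field
    weight   : Fin m → ℚ
    nonNeg   : ∀ i → 0ℚ ≤ weight i
    total    : sum weight ≡ 1ℚ
    combines : ∀ j → x j ≡ combination weight v j

  Support : Fin m → Set
  Support i = weight i ≢ 0ℚ

open _IsConvexCombinationOf_

-- Only points of nonzero weight have to lie in `C`, so both halves of a Radon partition can be
-- combinations of the same family, with disjoint supports.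
Convex : (ℚ^ d → Set) → Set
Convex {d} C = ∀ {m} {x : ℚ^ d} {v : Fin m → ℚ^ d} (x∈v : x IsConvexCombinationOf v) →
  (∀ i → Support x∈v i → C (v i)) → C x

⇒-convex : {C : ℚ^ d → Set} (A : Set) → Convex C → Convex (λ x → A → C x)
⇒-convex A convex x∈v C-v a = convex x∈v λ i i∈ → C-v i i∈ a

-- The two sides of an affine dependency, rescaled, are the two convex combinations.
radon : d ℕ.< m → (v : Fin (suc m) → ℚ^ d) →
  Σ[ x ∈ ℚ^ d ] Σ[ x∈v ∈ x IsConvexCombinationOf v ] Σ[ x∈v′ ∈ x IsConvexCombinationOf v ]
    (∀ i → ¬ Support x∈v i ⊎ ¬ Support x∈v′ i)
radon {d} {m} d<m v = x , convex⁺ , convex⁻ , disjoint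
  where
  -- The added coordinate `1` makes the coefficients sum to zero, so their positive and negative
  -- parts have the same total `S`.
  lifted : Fin (suc m) → ℚ^ (suc d)
  lifted i zero    = 1ℚ
  lifted i (suc j) = v i j

  dependency = linearlyDependent (suc d) (ℕ.s≤s d<m) lifted
  c    = proj₁ dependency
  i₀   = proj₁ (proj₁ (proj₂ dependency))
  eqs  = proj₂ (proj₂ dependency)

  c⁺ c⁻ : Fin (suc m) → ℚ
  c⁺ i = c i ⊔ 0ℚ
  c⁻ i = - c i ⊔ 0ℚ

  ⊔0-split : ∀ p → p ⊔ 0ℚ ≡ p + (- p ⊔ 0ℚ)
  ⊔0-split p with ≤-total 0ℚ p
  ... | inj₁ 0≤p = begin
    p ⊔ 0ℚ          ≡⟨ p≥q⇒p⊔q≡p 0≤p ⟩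
    p               ≡⟨ +-identityʳ p ⟨
    p + 0ℚ          ≡⟨ cong (p +_) (p≤q⇒p⊔q≡q (neg-antimono-≤ 0≤p)) ⟨
    p + (- p ⊔ 0ℚ)  ∎
    where open ≡-Reasoning
  ... | inj₂ p≤0 = begin
    p ⊔ 0ℚ          ≡⟨ p≤q⇒p⊔q≡q p≤0 ⟩
    0ℚ              ≡⟨ +-inverseʳ p ⟨
    p + - p         ≡⟨ cong (p +_) (p≥q⇒p⊔q≡p (neg-antimono-≤ p≤0)) ⟨
    p + (- p ⊔ 0ℚ)  ∎
    where open ≡-Reasoning

  balanced : ∀ f → sum (λ i → c i * f i) ≡ 0ℚ →
    sum (λ i → c⁺ i * f i) ≡ sum (λ i → c⁻ i * f i)
  balanced f cf≡0 = begin
    sum (λ i → c⁺ i * f i)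
      ≡⟨ sum-cong-≗ (λ i → trans (cong (_* f i) (⊔0-split (c i))) (*-distribʳ-+ (f i) (c i) (c⁻ i))) ⟩
    sum (λ i → c i * f i + c⁻ i * f i)
      ≡⟨ ∑-distrib-+ (λ i → c i * f i) (λ i → c⁻ i * f i) ⟩
    sum (λ i → c i * f i) + sum (λ i → c⁻ i * f i)
      ≡⟨ cong (_+ sum (λ i → c⁻ i * f i)) cf≡0 ⟩
    0ℚ + sum (λ i → c⁻ i * f i)
      ≡⟨ +-identityˡ _ ⟩
    sum (λ i → c⁻ i * f i) ∎
    where open ≡-Reasoning

  c⁺-nonNeg : ∀ i → 0ℚ ≤ c⁺ i
  c⁺-nonNeg i = p≤q⊔p (c i) 0ℚ
  c⁻-nonNeg : ∀ i → 0ℚ ≤ c⁻ i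
  c⁻-nonNeg i = p≤q⊔p (- c i) 0ℚ

  S = sum c⁺

  c⁻-sum : sum c⁻ ≡ S
  c⁻-sum = begin
    sum c⁻                   ≡⟨ sum-cong-≗ (λ i → *-identityʳ (c⁻ i)) ⟨
    sum (λ i → c⁻ i * 1ℚ)    ≡⟨ balanced (λ _ → 1ℚ) (eqs zero) ⟨
    sum (λ i → c⁺ i * 1ℚ)    ≡⟨ sum-cong-≗ (λ i → *-identityʳ (c⁺ i)) ⟩
    S                        ∎
    where open ≡-Reasoning

  -- A nonzero coefficient contributes to `c⁺` or to `c⁻`, and both have total `S`.
  0<S : 0ℚ < S
  0<S with <-cmp (c i₀) 0ℚ
  ... | tri< c<0 _ _ = <-≤-trans (neg-antimono-< c<0)
    (≤-trans (p≤p⊔q (- c i₀) 0ℚ) (subst (c⁻ i₀ ≤_) c⁻-sum (term≤sum c⁻ c⁻-nonNeg i₀)))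
  ... | tri≈ _ c≡0 _ = contradiction c≡0 (proj₂ (proj₁ (proj₂ dependency)))
  ... | tri> _ _ 0<c = <-≤-trans 0<c (≤-trans (p≤p⊔q (c i₀) 0ℚ) (term≤sum c⁺ c⁺-nonNeg i₀))

  instance
    S-pos = positive 0<S
    S-nonZero = pos⇒nonZero S

  S⁻¹ = 1/ S

  0≤S⁻¹ : 0ℚ ≤ S⁻¹
  0≤S⁻¹ = nonNegative⁻¹ S⁻¹ {{pos⇒nonNeg S⁻¹ {{1/pos⇒pos S}}}}

  normalise : ∀ f → sum f ≡ S → sum (λ i → S⁻¹ * f i) ≡ 1ℚ
  normalise f eq = trans (sym (*-distribˡ-sum S⁻¹ f)) (trans (cong (S⁻¹ *_) eq) (*-inverseˡ S))

  x : ℚ^ d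
  x j = S⁻¹ * combination c⁺ v j

  pull : ∀ w j → S⁻¹ * combination w v j ≡ combination (λ i → S⁻¹ * w i) v j
  pull w j = trans (*-distribˡ-sum S⁻¹ (λ i → w i * v i j))
    (sum-cong-≗ λ i → sym (*-assoc S⁻¹ (w i) (v i j)))

  convex⁺ convex⁻ : x IsConvexCombinationOf v
  convex⁺ = record
    { weight   = λ i → S⁻¹ * c⁺ i
    ; nonNeg   = λ i → *-nonNeg 0≤S⁻¹ (c⁺-nonNeg i)
    ; total    = normalise c⁺ refl
    ; combines = pull c⁺ }
  convex⁻ = record
    { weight   = λ i → S⁻¹ * c⁻ i
    ; nonNeg   = λ i → *-nonNeg 0≤S⁻¹ (c⁻-nonNeg i)
    ; total    = normalise c⁻ c⁻-sum
    ; combines = λ j → trans (cong (S⁻¹ *_) (balanced (λ i → v i j) (eqs (suc j)))) (pull c⁻ j) }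

  disjoint : ∀ i → ¬ Support convex⁺ i ⊎ ¬ Support convex⁻ i
  disjoint i with ≤-total (c i) 0ℚ
  ... | inj₁ c≤0 = inj₁ λ ≢0 → ≢0 (trans (cong (S⁻¹ *_) (p≤q⇒p⊔q≡q c≤0)) (*-zeroʳ S⁻¹))
  ... | inj₂ 0≤c = inj₂ λ ≢0 →
    ≢0 (trans (cong (S⁻¹ *_) (p≤q⇒p⊔q≡q (neg-antimono-≤ 0≤c))) (*-zeroʳ S⁻¹))

-- Induction on the number of sets. Leaving out each set in turn gives one point per set. In a Radon
-- partition of these points each index `i` is missing from one of the two supports, and the points
-- used on that side all lie in `C i`.
helly : ∀ m (C : Fin m → ℚ^ d → Set) → (∀ i → Convex (C i)) →
  (∀ (t : Fin (suc d) → Fin m) → ∃[ x ] ∀ l → C (t l) x) →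
  ∃[ x ] ∀ i → C i x
helly zero C convex meet = (λ _ → 0ℚ) , λ ()
helly {d} (suc m) C convex meet with suc m ℕ.≤? suc d
... | yes m≤d = proj₁ (meet cover) , λ i → subst (λ i → C i _) (cover-inject i) (proj₂ (meet cover) (inject≤ i m≤d))
  where
  -- With at most `d + 1` sets one tuple lists them all; surplus positions repeat the first set.
  cover : Fin (suc d) → Fin (suc m)
  cover l with toℕ l ℕ.<? suc m
  ... | yes l<m = fromℕ< l<m
  ... | no  _   = zero
  cover-inject : ∀ i → cover (inject≤ i m≤d) ≡ i
  cover-inject i with toℕ (inject≤ i m≤d) ℕ.<? suc m
  ... | yes l<m = Fin.toℕ-injective (trans (Fin.toℕ-fromℕ< l<m) (toℕ-inject≤ i m≤d))
  ... | no  l≮m = contradiction (subst (ℕ._< suc m) (sym (toℕ-inject≤ i m≤d)) (toℕ<n i)) l≮m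
... | no m≰d = x , λ i → inAll i (separated i)
  where
  without : ∀ i → ∃[ y ] ∀ j → C (punchIn i j) y
  without i = helly m (C ∘ punchIn i) (convex ∘ punchIn i) (meet ∘ (punchIn i ∘_))

  partition = radon {m = m} (ℕ.s≤s⁻¹ (ℕ.≰⇒> m≰d)) (proj₁ ∘ without)
  x         = proj₁ partition
  separated = proj₂ (proj₂ (proj₂ partition))

  other : ∀ i j → j ≢ i → C i (proj₁ (without j))
  other i j j≢i = subst (λ i → C i _) (punchIn-punchOut j≢i) (proj₂ (without j) (punchOut j≢i))

  inside : ∀ i (x∈ : x IsConvexCombinationOf (proj₁ ∘ without)) → ¬ Support x∈ i → C i x
  inside i x∈ i∉ = convex i x∈ λ j j∈ → other i j λ { refl → i∉ j∈ }

  inAll : ∀ i → ¬ Support (proj₁ (proj₂ partition)) i ⊎ ¬ Support (proj₁ (proj₂ (proj₂ partition))) i → C i x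
  inAll i (inj₁ i∉) = inside i (proj₁ (proj₂ partition)) i∉
  inAll i (inj₂ i∉) = inside i (proj₁ (proj₂ (proj₂ partition))) i∉

-- Inner products; convexity of half-spaces and balls

dot : ℚ^ d → ℚ^ d → ℚ
dot x y = sum λ j → x j * y j

∥_∥² : ℚ^ d → ℚ
∥ x ∥² = dot x x

dot-comm : (x y : ℚ^ d) → dot x y ≡ dot y x
dot-comm x y = sum-cong-≗ λ j → *-comm (x j) (y j)

∥∥²-nonNeg : (x : ℚ^ d) → 0ℚ ≤ ∥ x ∥²
∥∥²-nonNeg x = sum-nonNeg _ λ j → square-nonNeg (x j)

lin : ℚ → ℚ^ d → ℚ → ℚ^ d → ℚ^ d
lin s x t y j = s * x j + t * y j

dot-linˡ : ∀ s (x : ℚ^ d) t y z → dot (lin s x t y) z ≡ s * dot x z + t * dot y z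
dot-linˡ s x t y z = begin
  dot (lin s x t y) z
    ≡⟨ sum-cong-≗ (λ j → expand s (x j) t (y j) (z j)) ⟩
  sum (λ j → s * (x j * z j) + t * (y j * z j))
    ≡⟨ ∑-distrib-+ (λ j → s * (x j * z j)) (λ j → t * (y j * z j)) ⟩
  sum (λ j → s * (x j * z j)) + sum (λ j → t * (y j * z j))
    ≡⟨ cong₂ _+_ (*-distribˡ-sum s (λ j → x j * z j)) (*-distribˡ-sum t (λ j → y j * z j)) ⟨
  s * dot x z + t * dot y z ∎
  where
  open ≡-Reasoning
  expand : ∀ s x t y z → (s * x + t * y) * z ≡ s * (x * z) + t * (y * z)
  expand = solve-∀ ℚ-ring

dot-linʳ : ∀ z s (x : ℚ^ d) t y → dot z (lin s x t y) ≡ s * dot z x + t * dot z y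
dot-linʳ z s x t y = trans (dot-comm z (lin s x t y))
  (trans (dot-linˡ s x t y z) (cong₂ (λ p q → s * p + t * q) (dot-comm x z) (dot-comm y z)))

∥lin∥² : ∀ s (x : ℚ^ d) t y →
  ∥ lin s x t y ∥² ≡ s * s * ∥ x ∥² + (s * t + s * t) * dot x y + t * t * ∥ y ∥²
∥lin∥² s x t y = begin
  ∥ lin s x t y ∥²
    ≡⟨ dot-linˡ s x t y (lin s x t y) ⟩
  s * dot x (lin s x t y) + t * dot y (lin s x t y)
    ≡⟨ cong₂ (λ p q → s * p + t * q) (dot-linʳ x s x t y) (dot-linʳ y s x t y) ⟩
  s * (s * dot x x + t * dot x y) + t * (s * dot y x + t * dot y y)
    ≡⟨ cong (λ p → s * (s * dot x x + t * dot x y) + t * (s * p + t * dot y y)) (dot-comm y x) ⟩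
  s * (s * dot x x + t * dot x y) + t * (s * dot x y + t * dot y y)
    ≡⟨ expand s t (dot x x) (dot x y) (dot y y) ⟩
  s * s * ∥ x ∥² + (s * t + s * t) * dot x y + t * t * ∥ y ∥² ∎
  where
  open ≡-Reasoning
  expand : ∀ s t a b c → s * (s * a + t * b) + t * (s * b + t * c) ≡ s * s * a + (s * t + s * t) * b + t * t * c
  expand = solve-∀ ℚ-ring

convex-dot : {x a : ℚ^ d} {v : Fin m → ℚ^ d} (x∈v : x IsConvexCombinationOf v) →
  dot x a ≡ sum λ i → weight x∈v i * dot (v i) a
convex-dot {x = x} {a} {v} x∈v = begin
  sum (λ j → x j * a j)
    ≡⟨ sum-cong-≗ (λ j → cong (_* a j) (combines x∈v j)) ⟩
  sum (λ j → combination w v j * a j)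
    ≡⟨ sum-cong-≗ (λ j → *-distribʳ-sum (a j) (λ i → w i * v i j)) ⟩
  sum (λ j → sum λ i → w i * v i j * a j)
    ≡⟨ ∑-comm (λ j i → w i * v i j * a j) ⟩
  sum (λ i → sum λ j → w i * v i j * a j)
    ≡⟨ sum-cong-≗ (λ i → sum-cong-≗ λ j → *-assoc (w i) (v i j) (a j)) ⟩
  sum (λ i → sum λ j → w i * (v i j * a j))
    ≡⟨ sum-cong-≗ (λ i → *-distribˡ-sum (w i) (λ j → v i j * a j)) ⟨
  sum (λ i → w i * dot (v i) a) ∎
  where
  open ≡-Reasoning
  w = weight x∈v

halfspace-convex : ∀ (a : ℚ^ d) β → Convex (λ x → dot x a ≤ β)
halfspace-convex a β {x = x} {v} x∈v v∈ = begin
  dot x a                        ≡⟨ convex-dot x∈v ⟩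
  sum (λ i → w i * dot (v i) a)  ≤⟨ sum-mono _ _ bound ⟩
  sum (λ i → w i * β)            ≡⟨ *-distribʳ-sum β w ⟨
  sum w * β                      ≡⟨ cong (_* β) (total x∈v) ⟩
  1ℚ * β                         ≡⟨ *-identityˡ β ⟩
  β                              ∎
  where
  open ≤-Reasoning
  w = weight x∈v
  bound : ∀ i → w i * dot (v i) a ≤ w i * β
  bound i with w i ≟ 0ℚ
  ... | no  w≢0 = *-monoˡ-≤-nonNeg (w i) {{nonNegative (nonNeg x∈v i)}} (v∈ i w≢0)
  ... | yes w≡0 = ≤-reflexive (begin-equality
    w i * dot (v i) a  ≡⟨ cong (_* dot (v i) a) w≡0 ⟩
    0ℚ * dot (v i) a   ≡⟨ *-zeroˡ (dot (v i) a) ⟩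
    0ℚ                 ≡⟨ *-zeroˡ β ⟨
    0ℚ * β             ≡⟨ cong (_* β) w≡0 ⟨
    w i * β            ∎)

-- The ball is an intersection of the half-spaces y · x ≤ (β + |x|²)/2.
ball-convex : ∀ β → Convex {d} (λ x → ∥ x ∥² ≤ β)
ball-convex β {x = x} {v} x∈v v∈ =
  by-slack ((½ * (β + ∥ x ∥²) - ∥ x ∥²) + (½ * (β + ∥ x ∥²) - ∥ x ∥²))
    (+-nonNeg (slack ineq) (slack ineq)) (double β ∥ x ∥²)
  where
  double : ∀ β a → β ≡ a + ((½ * (β + a) - a) + (½ * (β + a) - a))
  double = solve-∀ ℚ-ring
  tangent : ∀ β a b c → ½ * (β + a) ≡ b + ½ * ((β - c) + (1ℚ * 1ℚ * c + (1ℚ * (- 1ℚ) + 1ℚ * (- 1ℚ)) * b + - 1ℚ * - 1ℚ * a))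
  tangent = solve-∀ ℚ-ring
  ineq : ∥ x ∥² ≤ ½ * (β + ∥ x ∥²)
  ineq = halfspace-convex x (½ * (β + ∥ x ∥²)) x∈v λ i i∈ →
    by-slack _ (*-nonNeg (nonNegative⁻¹ ½) (+-nonNeg (slack (v∈ i i∈))
      (subst (0ℚ ≤_) (∥lin∥² 1ℚ (v i) (- 1ℚ) x) (∥∥²-nonNeg (lin 1ℚ (v i) (- 1ℚ) x)))))
      (tangent β ∥ x ∥² (dot (v i) x) ∥ v i ∥²)

-- Estimates for nearly minimal placements

⅛ ¼ : ℚ
¼ = ½ * ½
⅛ = ½ * ¼

0≤½ : 0ℚ ≤ ½
0≤½ = nonNegative⁻¹ ½

2* : ℚ → ℚ
2* p = p + p

scale : ℚ → ℚ^ d → ℚ^ d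
scale s x = lin s x 0ℚ x

dot-scaleˡ : ∀ s (x y : ℚ^ d) → dot (scale s x) y ≡ s * dot x y
dot-scaleˡ s x y = trans (dot-linˡ s x 0ℚ x y) (drop s (dot x y))
  where
  drop : ∀ s a → s * a + 0ℚ * a ≡ s * a
  drop = solve-∀ ℚ-ring

dot-scaleʳ : ∀ s (x y : ℚ^ d) → dot x (scale s y) ≡ s * dot x y
dot-scaleʳ s x y =
  trans (dot-comm x (scale s y)) (trans (dot-scaleˡ s y x) (cong (s *_) (dot-comm y x)))

dist² : ℚ^ d → ℚ^ d → ℚ
dist² x y = ∥ lin 1ℚ x (- 1ℚ) y ∥²

dist²-nonNeg : (x y : ℚ^ d) → 0ℚ ≤ dist² x y
dist²-nonNeg x y = ∥∥²-nonNeg (lin 1ℚ x (- 1ℚ) y)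

dist²-expand : (x y : ℚ^ d) → dist² x y ≡ ∥ x ∥² - 2* (dot x y) + ∥ y ∥²
dist²-expand x y = trans (∥lin∥² 1ℚ x (- 1ℚ) y) (tidy ∥ x ∥² (dot x y) ∥ y ∥²)
  where
  tidy : ∀ a b c → 1ℚ * 1ℚ * a + (1ℚ * - 1ℚ + 1ℚ * - 1ℚ) * b + - 1ℚ * - 1ℚ * c ≡ a - (b + b) + c
  tidy = solve-∀ ℚ-ring

square-gap : (x y : ℚ^ d) → 0ℚ ≤ ∥ x ∥² - 2* (dot x y) + ∥ y ∥²
square-gap x y = subst (0ℚ ≤_) (dist²-expand x y) (dist²-nonNeg x y)

dist²-self : (x : ℚ^ d) → dist² x x ≡ 0ℚ
dist²-self x = trans (dist²-expand x x) (cancel ∥ x ∥²)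
  where
  cancel : ∀ a → a - (a + a) + a ≡ 0ℚ
  cancel = solve-∀ ℚ-ring

-- A weak form of Cauchy-Schwarz, from `|x - y|² ≥ 0`, that involves no square roots.
dot-bound : ∀ {b} (x y : ℚ^ d) → ∥ x ∥² ≤ b → ∥ y ∥² ≤ b → dot x y ≤ b
dot-bound {b = b} x y x≤b y≤b = by-slack _
  (*-nonNeg 0≤½ (+-nonNeg (+-nonNeg (slack x≤b) (slack y≤b)) (square-gap x y)))
  (certificate b ∥ x ∥² (dot x y) ∥ y ∥²)
  where
  certificate : ∀ b a c e → b ≡ c + ½ * ((b - a) + (b - e) + (a - (c + c) + e))
  certificate = solve-∀ ℚ-ring

dist²-obtuse : (x y : ℚ^ d) → dot x y ≤ - 1ℚ → 1ℚ + 1ℚ ≤ dist² x y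
dist²-obtuse x y xy≤ = subst (1ℚ + 1ℚ ≤_) (sym (dist²-expand x y)) (by-slack _
  (+-nonNeg (+-nonNeg (∥∥²-nonNeg x) (∥∥²-nonNeg y)) (+-nonNeg (slack xy≤) (slack xy≤)))
  (certificate ∥ x ∥² (dot x y) ∥ y ∥²))
  where
  certificate : ∀ a c e → a - (c + c) + e ≡ 1ℚ + 1ℚ + (a + e + ((- 1ℚ - c) + (- 1ℚ - c)))
  certificate = solve-∀ ℚ-ring

module _ {τ : ℚ} (0≤τ : 0ℚ ≤ τ) (τ≤1 : τ ≤ 1ℚ) where

  mix-norm : ∀ {α B} (a x : ℚ^ d) → ∥ a ∥² ≤ B → ∥ x ∥² ≤ B - α →
    ∥ lin (1ℚ - τ) a τ x ∥² ≤ B - τ * α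
  mix-norm {α = α} {B} a x a≤B x≤B-α = subst (_≤ B - τ * α) (sym (∥lin∥² (1ℚ - τ) a τ x)) (by-slack _
    (+-nonNeg (+-nonNeg (*-nonNeg (slack τ≤1) (slack a≤B)) (*-nonNeg 0≤τ (slack x≤B-α)))
      (*-nonNeg (*-nonNeg 0≤τ (slack τ≤1)) (square-gap a x)))
    (certificate τ α B ∥ a ∥² (dot a x) ∥ x ∥²))
    where
    certificate : ∀ τ α B a c x → B - τ * α ≡
      ((1ℚ - τ) * (1ℚ - τ) * a + ((1ℚ - τ) * τ + (1ℚ - τ) * τ) * c + τ * τ * x)
      + ((1ℚ - τ) * (B - a) + τ * ((B - α) - x) + τ * (1ℚ - τ) * (a - (c + c) + x))
    certificate = solve-∀ ℚ-ring

  mix-obtuse : ∀ (a x w : ℚ^ d) → dot a w ≤ - 1ℚ → dot x w ≤ - 1ℚ →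
    dot (lin (1ℚ - τ) a τ x) w ≤ - 1ℚ
  mix-obtuse a x w aw≤ xw≤ = subst (_≤ - 1ℚ) (sym (dot-linˡ (1ℚ - τ) a τ x w)) (by-slack _
    (+-nonNeg (*-nonNeg (slack τ≤1) (slack aw≤)) (*-nonNeg 0≤τ (slack xw≤)))
    (certificate τ (dot a w) (dot x w)))
    where
    certificate : ∀ τ a x → - 1ℚ ≡ ((1ℚ - τ) * a + τ * x) + ((1ℚ - τ) * (- 1ℚ - a) + τ * (- 1ℚ - x))
    certificate = solve-∀ ℚ-ring

stretch-obtuse : ∀ {c} → 1ℚ ≤ c → (x y : ℚ^ d) → dot x y ≤ - 1ℚ → dot (scale c x) y ≤ - 1ℚ
stretch-obtuse {c = c} 1≤c x y xy≤ = subst (_≤ - 1ℚ) (sym (dot-scaleˡ c x y)) (by-slack _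
  (+-nonNeg (*-nonNeg (≤-trans (nonNegative⁻¹ 1ℚ) 1≤c) (slack xy≤)) (slack 1≤c))
  (certificate c (dot x y)))
  where
  certificate : ∀ c a → - 1ℚ ≡ c * a + (c * (- 1ℚ - a) + (c - 1ℚ))
  certificate = solve-∀ ℚ-ring

module Estimates (b γ : ℚ) (1≤b : 1ℚ ≤ b) (0<γ : 0ℚ < γ) (γb≤⅛ : γ * b ≤ ⅛) where

  0≤b : 0ℚ ≤ b
  0≤b = ≤-trans (nonNegative⁻¹ 1ℚ) 1≤b

  0≤γ : 0ℚ ≤ γ
  0≤γ = <⇒≤ 0<γ

  γ≤γb : γ ≤ γ * b
  γ≤γb = by-slack _ (*-nonNeg 0≤γ (slack 1≤b)) (certificate γ b)
    where
    certificate : ∀ γ b → γ * b ≡ γ + γ * (b - 1ℚ)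
    certificate = solve-∀ ℚ-ring

  γ≤⅛ : γ ≤ ⅛
  γ≤⅛ = ≤-trans γ≤γb γb≤⅛

  ⅛≤1 : ⅛ ≤ 1ℚ
  ⅛≤1 = by-slack (1ℚ - ⅛) (nonNegative⁻¹ (1ℚ - ⅛)) refl

  γ≤1 : γ ≤ 1ℚ
  γ≤1 = ≤-trans γ≤⅛ ⅛≤1

  -- The squared factor is at most `1 + 3 κ γ`, and the increase `3 κ γ b` is at most 3/8 of the
  -- margin `κ`.
  stretch-norm : ∀ {B κ} → B ≤ b → 0ℚ ≤ κ → κ ≤ 1ℚ → (w : ℚ^ d) → ∥ w ∥² ≤ B - κ →
    ∥ scale (1ℚ + κ * γ) w ∥² ≤ B - ½ * κ
  stretch-norm {B = B} {κ} B≤b 0≤κ κ≤1 w w≤ =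
    subst (_≤ B - ½ * κ) (sym (trans (dot-scaleˡ c w (scale c w)) (cong (c *_) (dot-scaleʳ c w w)))) (by-slack _
      (+-nonNeg (+-nonNeg (+-nonNeg (+-nonNeg (slack w≤)
        (*-nonNeg (+-nonNeg (+-nonNeg 0≤λ 0≤λ) 0≤λ) (slack w≤b)))
        (*-nonNeg (*-nonNeg 0≤λ (slack λ≤1)) (∥∥²-nonNeg w)))
        (*-nonNeg (+-nonNeg (+-nonNeg 0≤κ 0≤κ) 0≤κ) (slack γb≤⅛)))
        (*-nonNeg (nonNegative⁻¹ ⅛) 0≤κ))
      (certificate κ γ b B ∥ w ∥²))
    where
    c   = 1ℚ + κ * γ
    0≤λ : 0ℚ ≤ κ * γ
    0≤λ = *-nonNeg 0≤κ 0≤γ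
    λ≤1 : κ * γ ≤ 1ℚ
    λ≤1 = by-slack _ (+-nonNeg (slack κ≤1) (*-nonNeg 0≤κ (slack γ≤1))) (certificate₁ κ γ)
      where
      certificate₁ : ∀ κ γ → 1ℚ ≡ κ * γ + ((1ℚ - κ) + κ * (1ℚ - γ))
      certificate₁ = solve-∀ ℚ-ring
    w≤b : ∥ w ∥² ≤ b
    w≤b = by-slack _ (+-nonNeg (+-nonNeg (slack w≤) 0≤κ) (slack B≤b)) (certificate₂ B κ b ∥ w ∥²)
      where
      certificate₂ : ∀ B κ b w → b ≡ w + (((B - κ) - w) + κ + (b - B))
      certificate₂ = solve-∀ ℚ-ring
    certificate : ∀ κ γ b B w → B - ½ * κ ≡ (1ℚ + κ * γ) * ((1ℚ + κ * γ) * w)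
      + (((B - κ) - w) + (κ * γ + κ * γ + κ * γ) * (b - w) + κ * γ * (1ℚ - κ * γ) * w
         + (κ + κ + κ) * (½ * (½ * ½) - γ * b) + ½ * (½ * ½) * κ)
    certificate = solve-∀ ℚ-ring

  -- Moving `a` towards `x`, which need not be obtuse to `w`, costs at most `l γ (1 + b)`. This is
  -- at most `l / 4`, and lengthening `w` by the factor `1 + l` makes up for it.
  mix-stretch-obtuse : ∀ {l} → 0ℚ ≤ l → l ≤ 1ℚ → (a x w : ℚ^ d) →
    dot a w ≤ - 1ℚ → ∥ x ∥² ≤ b → ∥ w ∥² ≤ b →
    dot (lin (1ℚ - l * γ) a (l * γ) x) (scale (1ℚ + l) w) ≤ - 1ℚ
  mix-stretch-obtuse {l = l} 0≤l l≤1 a x w aw≤ x≤b w≤b =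
    subst (_≤ - 1ℚ) (sym (trans (dot-scaleʳ (1ℚ + l) (lin (1ℚ - τ) a τ x) w) (cong ((1ℚ + l) *_) (dot-linˡ (1ℚ - τ) a τ x w)))) (by-slack _
      (+-nonNeg (+-nonNeg (+-nonNeg (+-nonNeg (+-nonNeg
        (*-nonNeg (*-nonNeg 0≤1+l (slack τ≤1)) (slack aw≤))
        (*-nonNeg (*-nonNeg 0≤1+l 0≤τ) (slack (dot-bound x w x≤b w≤b))))
        (*-nonNeg (*-nonNeg (slack l≤1) 0≤τ) (+-nonNeg (nonNegative⁻¹ 1ℚ) 0≤b)))
        (*-nonNeg (+-nonNeg 0≤τ 0≤τ) (slack 1≤b)))
        (*-nonNeg (+-nonNeg (+-nonNeg 0≤l 0≤l) (+-nonNeg 0≤l 0≤l)) (slack γb≤⅛)))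
        (*-nonNeg 0≤½ 0≤l))
      (certificate l γ b (dot a w) (dot x w)))
    where
    τ = l * γ
    0≤τ : 0ℚ ≤ τ
    0≤τ = *-nonNeg 0≤l 0≤γ
    0≤1+l : 0ℚ ≤ 1ℚ + l
    0≤1+l = +-nonNeg (nonNegative⁻¹ 1ℚ) 0≤l
    τ≤1 : τ ≤ 1ℚ
    τ≤1 = by-slack _ (+-nonNeg (slack l≤1) (*-nonNeg 0≤l (slack γ≤1))) (certificate₁ l γ)
      where
      certificate₁ : ∀ κ γ → 1ℚ ≡ κ * γ + ((1ℚ - κ) + κ * (1ℚ - γ))
      certificate₁ = solve-∀ ℚ-ring
    certificate : ∀ l γ b a x → - 1ℚ ≡ (1ℚ + l) * ((1ℚ - l * γ) * a + l * γ * x)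
      + ((1ℚ + l) * (1ℚ - l * γ) * (- 1ℚ - a) + (1ℚ + l) * (l * γ) * (b - x)
         + (1ℚ - l) * (l * γ) * (1ℚ + b) + (l * γ + l * γ) * (b - 1ℚ)
         + (l + l + (l + l)) * (½ * (½ * ½) - γ * b) + ½ * l)
    certificate = solve-∀ ℚ-ring

  -- In `y · w = y · z + y · (w - z)` the last term is at most `η b`: expand `|η y + (z - w)|² ≥ 0`
  -- and cancel `η`.
  nearly-obtuse : ∀ {η} → 0ℚ < η → (y z w : ℚ^ d) →
    ∥ y ∥² ≤ b → dot y z ≤ - 1ℚ → dist² z w ≤ η * η → dot y w ≤ - 1ℚ + η * b
  nearly-obtuse {η = η} 0<η y z w y≤b yz≤ zw≤ = by-slack _
    (+-nonNeg (slack yz≤) (slack tilt)) (certificate (η * b) (dot y z) (dot y w))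
    where
    certificate : ∀ e z w → - 1ℚ + e ≡ w + ((- 1ℚ - z) + (e - (w - z)))
    certificate = solve-∀ ℚ-ring
    g  = lin 1ℚ z (- 1ℚ) w
    yg : dot y g ≡ dot y z - dot y w
    yg = trans (dot-linʳ y 1ℚ z (- 1ℚ) w) (tidy (dot y z) (dot y w))
      where
      tidy : ∀ z w → 1ℚ * z + - 1ℚ * w ≡ z - w
      tidy = solve-∀ ℚ-ring
    tilt : dot y w - dot y z ≤ η * b
    tilt = *-cancelˡ-≤-pos η {{positive 0<η}} (by-slack _
      (*-nonNeg 0≤½ (+-nonNeg (+-nonNeg (+-nonNeg
        (*-nonNeg (square-nonNeg η) (slack y≤b))
        (*-nonNeg (square-nonNeg η) (slack 1≤b)))
        (slack zw≤))
        (∥∥²-nonNeg (lin η y 1ℚ g))))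
      (trans (certificate₁ η b ∥ y ∥² (dot y z) (dot y w) ∥ g ∥²)
        (cong (λ s → η * (dot y w - dot y z) + ½ * (η * η * (b - ∥ y ∥²) + η * η * (b - 1ℚ) + (η * η - ∥ g ∥²) + s))
          (sym (trans (∥lin∥² η y 1ℚ g) (cong (λ s → η * η * ∥ y ∥² + (η * 1ℚ + η * 1ℚ) * s + 1ℚ * 1ℚ * ∥ g ∥²) yg))))))
      where
      certificate₁ : ∀ η b y z w g → η * (η * b) ≡ η * (w - z)
        + ½ * (η * η * (b - y) + η * η * (b - 1ℚ) + (η * η - g)
               + (η * η * y + (η * 1ℚ + η * 1ℚ) * (z - w) + 1ℚ * 1ℚ * g))
      certificate₁ = solve-∀ ℚ-ring

  module Midpoint {Q α B : ℚ} (0≤Q : 0ℚ ≤ Q) (Q≤1 : Q ≤ 1ℚ) (α≤η : α ≤ γ * γ * Q) (B≤b : B ≤ b)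
    (u y : ℚ^ d) (u≤B : ∥ u ∥² ≤ B) (y≤B : ∥ y ∥² ≤ B) (Q≤uy : Q ≤ dist² y u) where

    private
      e = γ * γ * Q * b
      h = ½ * (1ℚ + e)
      Δ = dist² y u

    -- By the parallelogram law the true midpoint has squared norm at most `B - Δ / 4`. As `y` may
    -- miss obtuseness by `e`, it is lengthened by the factor `1 + e`; the gain survives because `e`
    -- is small compared with `Q`.
    midpoint : ℚ^ d
    midpoint = lin h y h u

    private
      0≤e : 0ℚ ≤ e
      0≤e = *-nonNeg (*-nonNeg (*-nonNeg 0≤γ 0≤γ) 0≤Q) 0≤b

      0≤h : 0ℚ ≤ h
      0≤h = *-nonNeg 0≤½ (+-nonNeg (nonNegative⁻¹ 1ℚ) 0≤e)

      e≤1 : e ≤ 1ℚ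
      e≤1 = by-slack _
        (+-nonNeg (+-nonNeg (*-nonNeg (*-nonNeg 0≤γ 0≤Q) (slack γb≤⅛)) (*-nonNeg (*-nonNeg (nonNegative⁻¹ ⅛) 0≤Q) (slack γ≤1)))
          (+-nonNeg (*-nonNeg (nonNegative⁻¹ ⅛) (slack Q≤1)) (nonNegative⁻¹ (1ℚ - ⅛))))
        (certificate γ Q b)
        where
        certificate : ∀ γ Q b → 1ℚ ≡ γ * γ * Q * b + (γ * Q * (½ * (½ * ½) - γ * b) + ½ * (½ * ½) * Q * (1ℚ - γ)
          + (½ * (½ * ½) * (1ℚ - Q) + (1ℚ - ½ * (½ * ½))))
        certificate = solve-∀ ℚ-ring

      0≤B : 0ℚ ≤ B
      0≤B = ≤-trans (∥∥²-nonNeg u) u≤B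

      -- α ≤ γ² Q ≤ (γ b)² Q and 3 e B ≤ 3 (γ b)² Q, so the left-hand side is at most Q / 16.
      gain : α + (e * B + e * B + e * B) ≤ ¼ * Δ
      gain = by-slack _
        (+-nonNeg (+-nonNeg (+-nonNeg (+-nonNeg (+-nonNeg
          (*-nonNeg (nonNegative⁻¹ ¼) (slack Q≤uy))
          (slack α≤η))
          (*-nonNeg 3e (slack B≤b)))
          (*-nonNeg (*-nonNeg 0≤Q (+-nonNeg 0≤g 0≤γ)) (slack γ≤γb)))
          (*-nonNeg (*-nonNeg 0≤Q (+-nonNeg 0≤g (nonNegative⁻¹ ⅛))) (+-nonNeg (+-nonNeg (slack γb≤⅛) (slack γb≤⅛)) (+-nonNeg (slack γb≤⅛) (slack γb≤⅛)))))
          (*-nonNeg (nonNegative⁻¹ (¼ - ¼ * ¼)) 0≤Q))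
        (certificate α γ Q b B Δ)
        where
        0≤g : 0ℚ ≤ γ * b
        0≤g = *-nonNeg 0≤γ 0≤b
        3e : 0ℚ ≤ e + e + e
        3e = +-nonNeg (+-nonNeg 0≤e 0≤e) 0≤e
        certificate : ∀ α γ Q b B Δ →
          ½ * ½ * Δ ≡ α + (γ * γ * Q * b * B + γ * γ * Q * b * B + γ * γ * Q * b * B)
            + (½ * ½ * (Δ - Q) + (γ * γ * Q - α) + (γ * γ * Q * b + γ * γ * Q * b + γ * γ * Q * b) * (b - B)
               + Q * (γ * b + γ) * (γ * b - γ)
               + Q * (γ * b + ½ * (½ * ½)) * (((½ * (½ * ½) - γ * b) + (½ * (½ * ½) - γ * b)) + ((½ * (½ * ½) - γ * b) + (½ * (½ * ½) - γ * b)))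
               + (½ * ½ - ½ * ½ * (½ * ½)) * Q)
        certificate = solve-∀ ℚ-ring

    -- Since `(1 + e)² ≤ 1 + 3 e`, the lengthening adds at most `3 e B`, which `gain` absorbs
    -- together with `α`.
    midpoint-norm : ∥ midpoint ∥² ≤ B - α
    midpoint-norm = subst (_≤ B - α) (sym (∥lin∥² h y h u)) (by-slack _
      (+-nonNeg (+-nonNeg (+-nonNeg
        (*-nonNeg (*-nonNeg 0≤h 0≤h) (+-nonNeg (+-nonNeg (slack y≤B) (slack u≤B)) (+-nonNeg (slack y≤B) (slack u≤B))))
        (*-nonNeg (*-nonNeg 0≤e (slack e≤1)) 0≤B))
        (*-nonNeg (*-nonNeg (nonNegative⁻¹ ¼) (+-nonNeg (+-nonNeg 0≤e 0≤e) (*-nonNeg 0≤e 0≤e))) (dist²-nonNeg y u)))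
        (slack gain))
      (trans (certificate α B e ∥ y ∥² (dot y u) ∥ u ∥²)
        (cong (λ s → (h * h * ∥ y ∥² + (h * h + h * h) * dot y u + h * h * ∥ u ∥²)
          + (h * h * ((B - ∥ y ∥²) + (B - ∥ u ∥²) + ((B - ∥ y ∥²) + (B - ∥ u ∥²))) + e * (1ℚ - e) * B
             + ¼ * (e + e + e * e) * s + (¼ * s - (α + (e * B + e * B + e * B)))))
          (sym (dist²-expand y u)))))
      where
      certificate : ∀ α B e y c u → B - α ≡
        (½ * (1ℚ + e) * (½ * (1ℚ + e)) * y + (½ * (1ℚ + e) * (½ * (1ℚ + e)) + ½ * (1ℚ + e) * (½ * (1ℚ + e))) * c + ½ * (1ℚ + e) * (½ * (1ℚ + e)) * u)
        + (½ * (1ℚ + e) * (½ * (1ℚ + e)) * ((B - y) + (B - u) + ((B - y) + (B - u))) + e * (1ℚ - e) * B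
           + ½ * ½ * (e + e + e * e) * (y - (c + c) + u) + (½ * ½ * (y - (c + c) + u) - (α + (e * B + e * B + e * B))))
      certificate = solve-∀ ℚ-ring

    -- Averaging halves the deficit `e`, and `(1 + e) (1 - e / 2) ≥ 1` because `e ≤ 1`.
    midpoint-obtuse : ∀ (w : ℚ^ d) → dot u w ≤ - 1ℚ → dot y w ≤ - 1ℚ + e → dot midpoint w ≤ - 1ℚ
    midpoint-obtuse w uw≤ yw≤ = subst (_≤ - 1ℚ) (sym (dot-linˡ h y h u w)) (by-slack _
      (+-nonNeg (+-nonNeg (*-nonNeg 0≤h (slack yw≤)) (*-nonNeg 0≤h (slack uw≤)))
        (*-nonNeg (*-nonNeg 0≤½ 0≤e) (slack e≤1)))
      (certificate e (dot y w) (dot u w)))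
      where
      certificate : ∀ e y u → - 1ℚ ≡ (½ * (1ℚ + e) * y + ½ * (1ℚ + e) * u)
        + (½ * (1ℚ + e) * ((- 1ℚ + e) - y) + ½ * (1ℚ + e) * (- 1ℚ - u) + ½ * e * (1ℚ - e))
      certificate = solve-∀ ℚ-ring

-- From stable families to long range action

depth : ∀ {r} → Site r → ℕ
depth root         = 0
depth (branch _ p) = suc (length p)

depth-⋖ : ∀ {r} {s t : Site r} → s ⋖ t → depth t ≡ suc (depth s)
depth-⋖ top  = refl
depth-⋖ down = refl

walk-depth : ∀ {r m} {s t : Site r} → Walk (𝕋 r) s t m → depth t ℕ.≤ depth s ℕ.+ m
walk-depth {s = s} [] = ℕ.≤-reflexive (sym (ℕ.+-identityʳ (depth s)))
walk-depth {m = suc m} {s} (_∷_ {v = v} e w) = ℕ.≤-trans (walk-depth w)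
  (ℕ.≤-trans (ℕ.+-monoˡ-≤ m (step e)) (ℕ.≤-reflexive (sym (ℕ.+-suc (depth s) m))))
  where
  step : s ⋖ v ⊎ v ⋖ s → depth v ℕ.≤ suc (depth s)
  step (inj₁ s⋖v) = ℕ.≤-reflexive (depth-⋖ s⋖v)
  step (inj₂ v⋖s) rewrite depth-⋖ v⋖s = ℕ.m≤n⇒m≤1+n (ℕ.n≤1+n (depth v))

_∷ʳʷ_ : ∀ {r m} {s t u : Site r} → Walk (𝕋 r) s t m → t ⋖ u → Walk (𝕋 r) s u (suc m)
[]      ∷ʳʷ e = inj₁ e ∷ []
(f ∷ w) ∷ʳʷ e = f ∷ (w ∷ʳʷ e)

rootWalk : ∀ {r} (s : Site r) → Walk (𝕋 r) root s (depth s)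
rootWalk root               = []
rootWalk (branch a [])      = [] ∷ʳʷ top
rootWalk (branch a (b ∷ p)) = rootWalk (branch a p) ∷ʳʷ down

depth-atDistance : ∀ {r} (s : Site r) → AtDistance (𝕋 r) (depth s) root s
depth-atDistance s = rootWalk s , λ _ → walk-depth

-- The interface between the geometry and the tree: each active node has `r` active neighbours, one
-- for each child of a non-root site, and they pass nearness up one level.
record StableFamily (H : FiniteGraph) (r : ℕ) : Set₁ where
  open FiniteGraph H
  field
    Active    : Fin order → Set
    Near      : Fin order → Fin order → Set
    near-refl : ∀ u → Near u u

  Forces : (Fin r → Fin order) → Fin order → Set
  Forces t u = ∀ y → (∀ i → ∃[ z ] y ~ z × Near (t i) z) → Near u y

  field
    children : ∀ u → Active u → Σ[ t ∈ (Fin r → Fin order) ] (∀ i → u ~ t i × Active (t i)) × Forces t u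
    base     : Fin order
    active   : Active base
    far      : Fin order
    ¬near    : ¬ Near base far

-- `φ` labels the tree downwards from `base` by the chosen `children`. If `ψ` agrees with it at
-- depth `n`, then `Forces` carries nearness up to the root, where `far` is excluded.
stable⇒longRange : ∀ (H : FiniteGraph) r → StableFamily H (suc r) →
  LongRangeAction (𝕋 (suc r)) root (FiniteGraph.graph H)
stable⇒longRange H r family = φ , far , λ n _ (ψ , agree , ψ-root) →
  ¬near (subst (Near base) ψ-root (forced n ψ agree n root refl))
  where
  open FiniteGraph H
  open StableFamily family

  child : Σ[ u ∈ Fin order ] Active u → Fin (suc r) → Σ[ u ∈ Fin order ] Active u
  child (u , a) i with children u a
  ... | t , nbrs , _ = t i , proj₂ (nbrs i)

  child-adj : ∀ ua i → proj₁ ua ~ proj₁ (child ua i)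
  child-adj (u , a) i with children u a
  ... | t , nbrs , _ = proj₁ (nbrs i)

  child-forces : ∀ ua → Forces (λ i → proj₁ (child ua i)) (proj₁ ua)
  child-forces (u , a) with children u a
  ... | t , _ , forces = forces

  -- The root has one child more than the others; it repeats a value.
  rootChild : Fin (suc (suc r)) → Fin (suc r)
  rootChild zero    = zero
  rootChild (suc i) = i

  label : Site (suc r) → Σ[ u ∈ Fin order ] Active u
  label root               = base , active
  label (branch a [])      = child (base , active) (rootChild a)
  label (branch a (b ∷ p)) = child (label (branch a p)) b

  label-⋖ : ∀ {s t} → s ⋖ t → proj₁ (label s) ~ proj₁ (label t)
  label-⋖ (top {a})            = child-adj (base , active) (rootChild a)
  label-⋖ (down {a} {b} {p})   = child-adj (label (branch a p)) b

  φ : Hom (𝕋 (suc r)) graph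
  φ = record
    { map       = λ s → proj₁ (label s)
    ; preserves = λ { (inj₁ s⋖t) → label-⋖ s⋖t ; (inj₂ t⋖s) → ~-sym (label-⋖ t⋖s) } }

  -- The children used by the induction; at the root the extra child `zero` is skipped, matching
  -- `rootChild`.
  below : Site (suc r) → Fin (suc r) → Site (suc r)
  below root         i = branch (suc i) []
  below (branch a p) i = branch a (i ∷ p)

  below-⋖ : ∀ s i → s ⋖ below s i
  below-⋖ root         i = top
  below-⋖ (branch _ _) i = down

  label-below : ∀ s i → label (below s i) ≡ child (label s) i
  label-below root         i = refl
  label-below (branch _ _) i = refl

  forced : ∀ n (ψ : Hom (𝕋 (suc r)) graph) →
    (∀ s → AtDistance (𝕋 (suc r)) n root s → Hom.map ψ s ≡ Hom.map φ s) →
    ∀ h s → depth s ℕ.+ h ≡ n → Near (proj₁ (label s)) (Hom.map ψ s)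
  forced n ψ agree zero s eq = subst (Near _)
    (sym (agree s (subst (λ n → AtDistance _ n root s) (trans (sym (ℕ.+-identityʳ (depth s))) eq) (depth-atDistance s))))
    (near-refl _)
  forced n ψ agree (suc h) s eq = child-forces (label s) (Hom.map ψ s) λ i →
    Hom.map ψ (below s i) , Hom.preserves ψ (inj₁ (below-⋖ s i)) ,
    subst (λ ua → Near (proj₁ ua) (Hom.map ψ (below s i))) (label-below s i)
      (forced n ψ agree h (below s i)
        (trans (cong (ℕ._+ h) (depth-⋖ (below-⋖ s i))) (trans (sym (ℕ.+-suc (depth s) h)) eq)))

-- Improving a placement

anyVec? : ∀ l {P : Vec (Fin n) l → Set} → (∀ t → Dec (P t)) → Dec (∃ P)
anyVec? zero    P? = map′ ([] ,_) (λ { ([] , p) → p }) (P? [])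
anyVec? (suc l) P? = map′ (λ (x , t , p) → x ∷ t , p) (λ { (x ∷ t , p) → x , t , p })
  (any? λ x → anyVec? l λ t → P? (x ∷ t))

-- The `m + 1` open intervals from `ε (suc j)` to `ε j` are disjoint, so by pigeonhole one of them
-- contains none of the `m` values.
skipped-interval : ∀ (ε : ℕ → ℚ) → (∀ {i j} → i ℕ.≤ j → ε j ≤ ε i) → (f : Fin m → ℚ) →
  ∃[ j ] j ℕ.≤ m × ∀ i → f i ≤ ε (suc j) ⊎ ε j ≤ f i
skipped-interval {m} ε antitone f = found (any? {n = suc m} λ j → all? (clear? j))
  where
  Clear : Fin (suc m) → Fin m → Set
  Clear j i = f i ≤ ε (suc (toℕ j)) ⊎ ε (toℕ j) ≤ f i

  clear? : ∀ j i → Dec (Clear j i)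
  clear? j i = (f i ≤? ε (suc (toℕ j))) ⊎-dec (ε (toℕ j) ≤? f i)

  found : Dec (∃[ j ] ∀ i → Clear j i) → ∃[ j ] j ℕ.≤ m × ∀ i → f i ≤ ε (suc j) ⊎ ε j ≤ f i
  found (yes (j , clear)) = toℕ j , toℕ≤pred[n] j , clear
  found (no none) = contradiction repeated ¬repeated
    where
    blocked : ∀ j → ∃[ i ] ¬ Clear j i
    blocked j = ¬∀⟶∃¬ _ _ (clear? j) λ clear → none (j , clear)
    repeated = pigeonhole (ℕ.n<1+n m) (proj₁ ∘ blocked)
    ¬repeated : ¬ (∃₂ λ j l → toℕ j ℕ.< toℕ l × proj₁ (blocked j) ≡ proj₁ (blocked l))
    ¬repeated (j , l , j<l , eq) = proj₂ (blocked j) (inj₁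
      (≤-trans (subst (λ i → f i ≤ ε (toℕ l)) (sym eq) (<⇒≤ (≰⇒> (proj₂ (blocked l) ∘ inj₂)))) (antitone j<l)))

module Placements (H : FiniteGraph) (d : ℕ) where
  open FiniteGraph H

  Placement : Set
  Placement = Fin order → ℚ^ d

  Obtuse : Placement → Set
  Obtuse F = ∀ {u v} → u ~ v → dot (F u) (F v) ≤ - 1ℚ

  record Placeable (B : ℚ) : Set where
    field
      F       : Placement
      obtuse  : Obtuse F
      bounded : ∀ u → ∥ F u ∥² ≤ B

  -- For an edge, `|F u + F v|² ≥ 0` gives `2 B ≥ - 2 (F u · F v) ≥ 2`. This is what stops the
  -- descent in `B`.
  1≤bound : HasEdge → ∀ {B} → Placeable B → 1ℚ ≤ B
  1≤bound (u , v , u~v) {B} P = by-slack _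
    (*-nonNeg 0≤½ (+-nonNeg (+-nonNeg (+-nonNeg (slack (bounded u)) (slack (bounded v)))
      (+-nonNeg (slack (obtuse u~v)) (slack (obtuse u~v)))) (∥∥²-nonNeg (lin 1ℚ (F u) 1ℚ (F v)))))
    (trans (certificate B ∥ F u ∥² (dot (F u) (F v)) ∥ F v ∥²)
      (cong (λ s → 1ℚ + ½ * ((B - ∥ F u ∥²) + (B - ∥ F v ∥²) + ((- 1ℚ - dot (F u) (F v)) + (- 1ℚ - dot (F u) (F v))) + s))
        (sym (∥lin∥² 1ℚ (F u) 1ℚ (F v)))))
    where
    open Placeable P
    certificate : ∀ B a c e → B ≡ 1ℚ + ½ * ((B - a) + (B - e) + ((- 1ℚ - c) + (- 1ℚ - c))
      + (1ℚ * 1ℚ * a + (1ℚ * 1ℚ + 1ℚ * 1ℚ) * c + 1ℚ * 1ℚ * e))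
    certificate = solve-∀ ℚ-ring

-- Releasing nodes one at a time

module Improvement (H : FiniteGraph) (r : ℕ) (b γ : ℚ)
  (1≤b : 1ℚ ≤ b) (0<γ : 0ℚ < γ) (γb≤⅛ : γ * b ≤ ⅛) where
  open FiniteGraph H
  open Placements H (suc r)
  open Estimates b γ 1≤b 0<γ γb≤⅛

  private
    d′ = suc r

  -- Candidate thresholds of nearness. Each is `γ²` times the square of the one before, so errors of
  -- size `ladder (suc j)` are small against the squared distance `ladder² j`, as `Midpoint`
  -- requires.
  ladder : ℕ → ℚ
  ladder zero    = γ
  ladder (suc j) = γ * γ * (ladder j * ladder j)

  ladder-pos : ∀ j → 0ℚ < ladder j
  ladder-pos zero    = 0<γ
  ladder-pos (suc j) = *-pos (*-pos 0<γ 0<γ) (*-pos (ladder-pos j) (ladder-pos j))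

  ladder-nonNeg : ∀ j → 0ℚ ≤ ladder j
  ladder-nonNeg j = <⇒≤ (ladder-pos j)

  ladder-step : ∀ j → ladder j ≤ 1ℚ → ladder (suc j) ≤ ladder j
  ladder-step j q≤1 = by-slack _
    (*-nonNeg (ladder-nonNeg j) (+-nonNeg (slack γ≤1) (*-nonNeg 0≤γ (+-nonNeg (slack γ≤1) (*-nonNeg 0≤γ (slack q≤1))))))
    (certificate γ (ladder j))
    where
    certificate : ∀ γ q → q ≡ γ * γ * (q * q) + q * ((1ℚ - γ) + γ * ((1ℚ - γ) + γ * (1ℚ - q)))
    certificate = solve-∀ ℚ-ring

  ladder≤1 : ∀ j → ladder j ≤ 1ℚ
  ladder≤1 zero    = γ≤1
  ladder≤1 (suc j) = ≤-trans (ladder-step j (ladder≤1 j)) (ladder≤1 j)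

  ladder-antitone : ∀ {i j} → i ℕ.≤ j → ladder j ≤ ladder i
  ladder-antitone i≤j = go (ℕ.≤⇒≤′ i≤j)
    where
    go : ∀ {i j} → i ℕ.≤′ j → ladder j ≤ ladder i
    go (ℕ.≤′-reflexive refl) = ≤-refl
    go (ℕ.≤′-step {j} i≤j) = ≤-trans (ladder-step j (ladder≤1 j)) (go i≤j)

  ladder² : ℕ → ℚ
  ladder² j = ladder j * ladder j

  ladder²-nonNeg : ∀ j → 0ℚ ≤ ladder² j
  ladder²-nonNeg j = *-nonNeg (ladder-nonNeg j) (ladder-nonNeg j)

  ladder²-antitone : ∀ {i j} → i ℕ.≤ j → ladder² j ≤ ladder² i
  ladder²-antitone {i} {j} i≤j = by-slack _
    (*-nonNeg (slack (ladder-antitone i≤j)) (+-nonNeg (ladder-nonNeg i) (ladder-nonNeg j)))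
    (certificate (ladder i) (ladder j))
    where
    certificate : ∀ p q → p * p ≡ q * q + (p - q) * (p + q)
    certificate = solve-∀ ℚ-ring

  ladder²≤1 : ∀ j → ladder² j ≤ 1ℚ
  ladder²≤1 j = by-slack _ (+-nonNeg (slack (ladder≤1 j)) (*-nonNeg (ladder-nonNeg j) (slack (ladder≤1 j))))
    (certificate (ladder j))
    where
    certificate : ∀ q → 1ℚ ≡ q * q + ((1ℚ - q) + q * (1ℚ - q))
    certificate = solve-∀ ℚ-ring

  -- `α` is at most every threshold `ladder (suc j)` with `j ≤ order²`, so it suits whichever gap is
  -- found. A release multiplies the margin `κ` by `θ`.
  α θ : ℚ
  α = ladder (suc (order ℕ.* order))
  θ = γ * γ * α

  0≤α : 0ℚ ≤ α
  0≤α = ladder-nonNeg (suc (order ℕ.* order))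

  0≤θ : 0ℚ ≤ θ
  0≤θ = *-nonNeg (*-nonNeg 0≤γ 0≤γ) 0≤α

  θ≤½ : θ ≤ ½
  θ≤½ = by-slack _
    (+-nonNeg (+-nonNeg (+-nonNeg (*-nonNeg (*-nonNeg 0≤γ 0≤γ) (slack (ladder≤1 (suc (order ℕ.* order))))) (*-nonNeg 0≤γ (slack γ≤1)))
      (slack γ≤⅛)) (nonNegative⁻¹ (½ - ⅛)))
    (certificate γ α)
    where
    certificate : ∀ γ α → ½ ≡ γ * γ * α + (γ * γ * (1ℚ - α) + γ * (1ℚ - γ) + (½ * (½ * ½) - γ) + (½ - ½ * (½ * ½)))
    certificate = solve-∀ ℚ-ring

  -- Nodes outside `U` have a margin `κ` below `B`; once `U` is empty, the bound has improved for
  -- all nodes.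
  record State (B κ : ℚ) (U : Subset order) (F : Placement) : Set where
    field
      obtuse   : Obtuse F
      bounded  : ∀ u → ∥ F u ∥² ≤ B
      released : ∀ u → u ∉ U → ∥ F u ∥² ≤ B - κ

  -- Only neighbours still in `U` constrain the target; released neighbours have room to be
  -- lengthened, which repairs the rest.
  record Releasable (B : ℚ) (U : Subset order) (F : Placement) (u : Fin order) : Set where
    field
      target  : ℚ^ d′
      shorter : ∥ target ∥² ≤ B - α
      obtuse  : ∀ w → u ~ w × w ∈ U → dot target (F w) ≤ - 1ℚ

  module Release {B κ U F u} (B≤b : B ≤ b) (0≤κ : 0ℚ ≤ κ) (κ≤1 : κ ≤ 1ℚ)
    (S : State B κ U F) (R : Releasable B U F u) where
    open State S
    open Releasable R using (target; shorter) renaming (obtuse to target-obtuse)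

    private
      -- Stretching by `1 + l` costs a released node at most half of its margin, and repairs a move
      -- by the fraction `τ`.
      l τ : ℚ
      l = κ * γ
      τ = l * γ

      0≤l : 0ℚ ≤ l
      0≤l = *-nonNeg 0≤κ 0≤γ

      shrink≤1 : ∀ {p} → 0ℚ ≤ p → p ≤ 1ℚ → p * γ ≤ 1ℚ
      shrink≤1 {p} 0≤p p≤1 = by-slack _ (+-nonNeg (slack p≤1) (*-nonNeg 0≤p (slack γ≤1))) (certificate p γ)
        where
        certificate : ∀ p γ → 1ℚ ≡ p * γ + ((1ℚ - p) + p * (1ℚ - γ))
        certificate = solve-∀ ℚ-ring

      l≤1 : l ≤ 1ℚ
      l≤1 = shrink≤1 0≤κ κ≤1

      0≤τ : 0ℚ ≤ τ
      0≤τ = *-nonNeg 0≤l 0≤γ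

      τ≤1 : τ ≤ 1ℚ
      τ≤1 = shrink≤1 0≤l l≤1

      1≤1+l : 1ℚ ≤ 1ℚ + l
      1≤1+l = by-slack l 0≤l refl

      κθ≤½κ : κ * θ ≤ ½ * κ
      κθ≤½κ = subst (κ * θ ≤_) (*-comm κ ½) (*-monoˡ-≤-nonNeg κ {{nonNegative 0≤κ}} θ≤½)

      below-B : ∀ {p q} → 0ℚ ≤ p → q ≤ B - p → q ≤ B
      below-B {p} {q} 0≤p q≤ = by-slack _ (+-nonNeg (slack q≤) 0≤p) (certificate B p q)
        where
        certificate : ∀ B p q → B ≡ q + (((B - p) - q) + p)
        certificate = solve-∀ ℚ-ring

    data Role (v : Fin order) : ℚ^ d′ → Set where
      moved     : v ≡ u → Role v (lin (1ℚ - τ) (F v) τ target)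
      kept      : v ≢ u → v ∈ U → Role v (F v)
      stretched : v ∉ U → Role v (scale (1ℚ + l) (F v))

    assign : ∀ v → ∃ (Role v)
    assign v with v Fin.≟ u | v ∈? U
    ... | yes v≡u | _       = _ , moved v≡u
    ... | no  v≢u | yes v∈U = _ , kept v≢u v∈U
    ... | no  _   | no  v∉U = _ , stretched v∉U

    F′ : Placement
    F′ v = proj₁ (assign v)

    private
      swap-dot : ∀ (x y : ℚ^ d′) → dot y x ≤ - 1ℚ → dot x y ≤ - 1ℚ
      swap-dot x y = subst (_≤ - 1ℚ) (dot-comm y x)

      target≤B : ∥ target ∥² ≤ B
      target≤B = below-B 0≤α shorter

      move : Fin order → ℚ^ d′
      move v = lin (1ℚ - τ) (F v) τ target

      stretch : Fin order → ℚ^ d′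
      stretch v = scale (1ℚ + l) (F v)

      stretch-kept : ∀ {v w} → v ~ w → dot (stretch v) (F w) ≤ - 1ℚ
      stretch-kept {v} {w} v~w = stretch-obtuse 1≤1+l (F v) (F w) (obtuse v~w)

      move-kept : ∀ {w} → u ~ w → w ∈ U → dot (move u) (F w) ≤ - 1ℚ
      move-kept {w} u~w w∈U =
        mix-obtuse 0≤τ τ≤1 (F u) target (F w) (obtuse u~w) (target-obtuse w (u~w , w∈U))

      move-stretch : ∀ {w} → u ~ w → dot (move u) (stretch w) ≤ - 1ℚ
      move-stretch {w} u~w = mix-stretch-obtuse 0≤l l≤1 (F u) target (F w)
        (obtuse u~w) (≤-trans target≤B B≤b) (≤-trans (bounded w) B≤b)

      stretch-released : ∀ {v} → v ∉ U → ∥ stretch v ∥² ≤ B - ½ * κ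
      stretch-released {v} v∉U = stretch-norm B≤b 0≤κ κ≤1 (F v) (released v v∉U)

    role-obtuse : ∀ {v w x y} → v ~ w → Role v x → Role w y → dot x y ≤ - 1ℚ
    -- A loop at `u` is impossible, since `|F u|²` is nonnegative.
    role-obtuse v~w (moved refl) (moved refl) =
      contradiction refl (<⇒≢ (≤-<-trans (≤-trans (∥∥²-nonNeg (F u)) (obtuse v~w)) (negative⁻¹ (- 1ℚ))))
    role-obtuse v~w (moved refl)  (kept _ w∈U)  = move-kept v~w w∈U
    role-obtuse v~w (moved refl)  (stretched _) = move-stretch v~w
    role-obtuse v~w (kept _ _)    (kept _ _)    = obtuse v~w
    role-obtuse v~w (stretched _) (kept _ _)    = stretch-kept v~w
    role-obtuse {v} {w} v~w (stretched _) (stretched _) =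
      stretch-obtuse 1≤1+l (F v) (stretch w) (swap-dot (F v) (stretch w) (stretch-kept (~-sym v~w)))
    role-obtuse {v} v~w (kept _ v∈U) (moved refl) =
      swap-dot (F v) (move u) (move-kept (~-sym v~w) v∈U)
    role-obtuse {v} v~w (stretched _) (moved refl) =
      swap-dot (stretch v) (move u) (move-stretch (~-sym v~w))
    role-obtuse {v} {w} v~w (kept _ _) (stretched _) =
      swap-dot (F v) (stretch w) (stretch-kept (~-sym v~w))

    move-norm : ∥ move u ∥² ≤ B - τ * α
    move-norm = mix-norm 0≤τ τ≤1 (F u) target (bounded u) shorter

    -- The move gains `τ α = κ θ` and a stretched node keeps `½ κ ≥ κ θ`, so one new margin fits
    -- both.
    role-released : ∀ {v x} → v ∉ U ∖ u → Role v x → ∥ x ∥² ≤ B - κ * θ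
    role-released _ (moved refl) = subst (λ s → ∥ move u ∥² ≤ B - s) (regroup κ γ α) move-norm
      where
      regroup : ∀ κ γ α → κ * γ * γ * α ≡ κ * (γ * γ * α)
      regroup = solve-∀ ℚ-ring
    role-released v∉ (kept v≢u v∈U) = contradiction (x∈p∧x≢y⇒x∈p-y v∈U v≢u) v∉
    role-released _ (stretched v∉U) =
      ≤-trans (stretch-released v∉U) (+-monoʳ-≤ B (neg-antimono-≤ κθ≤½κ))

    role-bounded : ∀ {v x} → Role v x → ∥ x ∥² ≤ B
    role-bounded (moved refl)    = below-B (*-nonNeg 0≤τ 0≤α) move-norm
    role-bounded {v} (kept _ _)  = bounded v
    role-bounded (stretched v∉U) = below-B (*-nonNeg 0≤½ 0≤κ) (stretch-released v∉U)

    release : State B (κ * θ) (U ∖ u) F′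
    release = record
      { obtuse   = λ {v} {w} v~w → role-obtuse v~w (proj₂ (assign v)) (proj₂ (assign w))
      ; bounded  = λ v → role-bounded (proj₂ (assign v))
      ; released = λ v v∉ → role-released v∉ (proj₂ (assign v)) }

  -- Controlled nodes and Helly's theorem

  ScaleGap : Placement → ℕ → Set
  ScaleGap F j = ∀ u y → dist² (F y) (F u) ≤ ladder² (suc j) ⊎ ladder² j ≤ dist² (F y) (F u)

  scaleGap : ∀ F → ∃[ j ] j ℕ.≤ order ℕ.* order × ScaleGap F j
  scaleGap F = unpair (skipped-interval ladder² ladder²-antitone (distance ∘ remQuot order))
    where
    distance : Fin order × Fin order → ℚ
    distance (y , u) = dist² (F y) (F u)

    unpair : (∃[ j ] j ℕ.≤ order ℕ.* order × (∀ i → distance (remQuot order i) ≤ ladder² (suc j)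
      ⊎ ladder² j ≤ distance (remQuot order i))) → ∃[ j ] j ℕ.≤ order ℕ.* order × ScaleGap F j
    unpair (j , j≤n² , clear) = j , j≤n² , λ u y →
      subst (λ p → distance p ≤ ladder² (suc j) ⊎ ladder² j ≤ distance p)
        (remQuot-combine y u) (clear (combine y u))

  module _ {B κ U F} (1≤B : 1ℚ ≤ B) (B≤b : B ≤ b) (S : State B κ U F)
    (j : ℕ) (j≤n² : j ℕ.≤ order ℕ.* order) (gap : ScaleGap F j) where
    open State S

    private
      η = ladder (suc j)

      α≤η : α ≤ η
      α≤η = ladder-antitone {suc j} {suc (order ℕ.* order)} (ℕ.s≤s j≤n²)

    Near : Fin order → Fin order → Set
    Near u y = dist² (F y) (F u) ≤ ladder² (suc j)

    near? : ∀ u y → Dec (Near u y)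
    near? u y = dist² (F y) (F u) ≤? ladder² (suc j)

    private
      far-apart : ∀ u y → ¬ Near u y → ladder² j ≤ dist² (F y) (F u)
      far-apart u y ¬near with gap u y
      ... | inj₁ near = contradiction near ¬near
      ... | inj₂ far  = far

    Sees : Fin order → Vec (Fin order) d′ → Set
    Sees y t = ∀ i → ∃[ z ] y ~ z × Near (lookup t i) z

    -- The condition `children` of a stable family whose active nodes are those of `U`; vectors let
    -- `anyVec?` search all tuples.
    Controls : Vec (Fin order) d′ → Fin order → Set
    Controls t u = (∀ i → u ~ lookup t i × lookup t i ∈ U) × (∀ y → Sees y t → Near u y)

    private
      forces? : ∀ t u y → Dec (Sees y t → Near u y)
      forces? t u y = (all? λ i → any? λ z → (y ~? z) ×-dec near? (lookup t i) z) →-dec near? u y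

      eligible? : ∀ u w → Dec (u ~ w × w ∈ U)
      eligible? u w = (u ~? w) ×-dec (w ∈? U)

    controlled? : ∀ u → Dec (∃[ t ] Controls t u)
    controlled? u = anyVec? d′ λ t → all? (λ i → eligible? u (lookup t i)) ×-dec all? (forces? t u)

    -- Helly's theorem for the ball and the half-spaces of the neighbours in U: the half-spaces
    -- alone meet in F u, and a (d′ + 1)-tuple with the ball leaves only d′ half-spaces.
    uncontrolled⇒releasable : ∀ u → ¬ (∃[ t ] Controls t u) → Releasable B U F u
    uncontrolled⇒releasable u ¬controlled with any? (eligible? u)
    -- Without neighbours in `U` the origin is a target, as `α ≤ 1 ≤ B`.
    ... | no none = record
      { target  = λ _ → 0ℚ
      ; shorter = subst (_≤ B - α) (sym (sum-zero {d′} (λ _ → 0ℚ * 0ℚ) λ _ → refl)) (slack (≤-trans (ladder≤1 (suc (order ℕ.* order))) 1≤B))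
      ; obtuse  = λ w w-eligible → contradiction (w , w-eligible) none }
    ... | yes (w₀ , w₀-eligible) = record
      { target  = proj₁ common
      ; shorter = proj₂ common zero
      ; obtuse  = λ w → proj₂ common (suc w) }
      where
      C : Fin (suc order) → ℚ^ d′ → Set
      C zero    x = ∥ x ∥² ≤ B - α
      C (suc w) x = u ~ w × w ∈ U → dot x (F w) ≤ - 1ℚ

      C-convex : ∀ i → Convex (C i)
      C-convex zero    = ball-convex (B - α)
      C-convex (suc w) = ⇒-convex (u ~ w × w ∈ U) (halfspace-convex (F w) (- 1ℚ))

      eligible : ∀ w → Dec (u ~ w × w ∈ U) → ∃[ v ] u ~ v × v ∈ U
      eligible w (yes w-eligible) = w , w-eligible
      eligible w (no _)           = w₀ , w₀-eligible

      eligible-self : ∀ w dec → u ~ w × w ∈ U → proj₁ (eligible w dec) ≡ w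
      eligible-self w (yes _)          _          = refl
      eligible-self w (no ¬w-eligible) w-eligible = contradiction w-eligible ¬w-eligible

      -- The ball and ineligible nodes are replaced by `w₀`, since a tuple can control `u` only if
      -- it consists of neighbours of `u` in `U`.
      pick : Fin (suc order) → ∃[ v ] u ~ v × v ∈ U
      pick zero    = w₀ , w₀-eligible
      pick (suc w) = eligible w (eligible? u w)

      meet-ball : ∀ (s : Fin d′ → Fin (suc order)) → ∃[ x ] C zero x × ∀ i → C (s i) x
      meet-ball s = midpoint , midpoint-norm , λ i → inside (s i) (below i)
        where
        t : Vec (Fin order) d′
        t = tabulate (proj₁ ∘ pick ∘ s)

        t-lookup : ∀ i → lookup t i ≡ proj₁ (pick (s i))
        t-lookup = lookup∘tabulate (proj₁ ∘ pick ∘ s)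

        -- As `t` does not control `u`, some `y` has neighbours near all entries of `t` without
        -- being near `u`; the gap then puts it at squared distance at least `ladder² j` from `u`.
        escape : ∃[ y ] ¬ (Sees y t → Near u y)
        escape = ¬∀⟶∃¬ order _ (forces? t u) λ forces → ¬controlled
          (t , (λ i → subst (λ v → u ~ v × v ∈ U) (sym (t-lookup i)) (proj₂ (pick (s i)))) , forces)

        y = proj₁ escape

        y-far : ¬ Near u y
        y-far near = proj₂ escape λ _ → near

        y-sees : Sees y t
        y-sees = decidable-stable (all? λ i → any? λ z → (y ~? z) ×-dec near? (lookup t i) z)
          λ ¬sees → proj₂ escape λ sees → contradiction sees ¬sees

        open Midpoint {Q = ladder² j} {α = α} {B = B} (ladder²-nonNeg j) (ladder²≤1 j) α≤η B≤b (F u) (F y)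
          (bounded u) (bounded y) (far-apart u y y-far)

        below : ∀ i → dot midpoint (F (proj₁ (pick (s i)))) ≤ - 1ℚ
        below i = subst (λ v → dot midpoint (F v) ≤ - 1ℚ) (t-lookup i)
          (midpoint-obtuse (F v)
            (obtuse (subst (u ~_) (sym (t-lookup i)) (proj₁ (proj₂ (pick (s i))))))
            (nearly-obtuse {η = η} (ladder-pos (suc j)) (F y) (F z) (F v) (≤-trans (bounded y) B≤b)
              (obtuse (proj₁ (proj₂ (y-sees i)))) (proj₂ (proj₂ (y-sees i)))))
          where
          v = lookup t i
          z = proj₁ (y-sees i)

        inside : ∀ i → dot midpoint (F (proj₁ (pick i))) ≤ - 1ℚ → C i midpoint
        inside zero    _                   = midpoint-norm
        inside (suc w) obtuse-w w-eligible =
          subst (λ v → dot midpoint (F v) ≤ - 1ℚ) (eligible-self w (eligible? u w) w-eligible) obtuse-w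

      meet : ∀ (t : Fin (suc d′) → Fin (suc order)) → ∃[ x ] ∀ i → C (t i) x
      meet t with any? (λ i → t i Fin.≟ zero)
      ... | no nonzero = F u , λ i → F-inside (t i) λ eq → nonzero (i , eq)
        where
        F-inside : ∀ i → i ≢ zero → C i (F u)
        F-inside zero    0≢0           = contradiction refl 0≢0
        F-inside (suc w) _ (u~w , _) = obtuse u~w
      ... | yes (i₀ , eq) = x , λ i → at i (i₀ Fin.≟ i)
        where
        meeting = meet-ball (t ∘ punchIn i₀)
        x = proj₁ meeting
        at : ∀ i → Dec (i₀ ≡ i) → C (t i) x
        at i (yes refl) = subst (λ l → C l x) (sym eq) (proj₁ (proj₂ meeting))
        at i (no i₀≢i)  = subst (λ l → C (t l) x) (punchIn-punchOut i₀≢i) (proj₂ (proj₂ meeting) (punchOut i₀≢i))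

      common : ∃[ x ] ∀ i → C i x
      common = helly (suc order) C C-convex meet

    stable-or-release : (∃[ u ] u ∈ U) → StableFamily H d′ ⊎ (∃[ u ] u ∈ U × Releasable B U F u)
    stable-or-release (u₀ , u₀∈U) with all? (λ u → (u ∈? U) →-dec controlled? u)
    ... | no ¬all = inj₂ (u , u∈U , uncontrolled⇒releasable u λ controlled → proj₂ bad λ _ → controlled)
      where
      bad = ¬∀⟶∃¬ order _ (λ u → (u ∈? U) →-dec controlled? u) ¬all
      u   = proj₁ bad
      u∈U : u ∈ U
      u∈U = decidable-stable (u ∈? U) λ u∉U → proj₂ bad λ u∈U → contradiction u∈U u∉U
    ... | yes controlled = inj₁ record
      { Active    = _∈ U
      ; Near      = Near
      ; near-refl = λ u → subst (_≤ ladder² (suc j)) (sym (dist²-self (F u))) (ladder²-nonNeg (suc j))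
      ; children  = λ u u∈U → let t , nbrs , forces = controlled u u∈U in lookup t , nbrs , forces
      ; base      = u₀
      ; active    = u₀∈U
      -- A neighbour of `u₀` is at squared distance at least 2, whereas near means at most
      -- `ladder² (suc j) ≤ 1`.
      ; far       = lookup t₀ zero
      ; ¬near     = λ near → contradiction refl (<⇒≢ (<-≤-trans (+-monoʳ-< 1ℚ (positive⁻¹ 1ℚ))
          (≤-trans (dist²-obtuse (F (lookup t₀ zero)) (F u₀) (obtuse (~-sym (proj₁ (proj₁ (proj₂ (controlled u₀ u₀∈U)) zero)))))
            (≤-trans near (ladder²≤1 (suc j)))))) }
      where
      t₀ = proj₁ (controlled u₀ u₀∈U)

  -- Emptying `U` and improving the bound

  shrunk : ℕ → ℚ → ℚ
  shrunk zero    κ = κ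
  shrunk (suc s) κ = shrunk s (κ * θ)

  κθ≤κ : ∀ {κ} → 0ℚ ≤ κ → κ * θ ≤ κ
  κθ≤κ {κ} 0≤κ = subst (κ * θ ≤_) (*-identityʳ κ)
    (*-monoˡ-≤-nonNeg κ {{nonNegative 0≤κ}} (≤-trans θ≤½ ½≤1))
    where
    ½≤1 : ½ ≤ 1ℚ
    ½≤1 = by-slack ½ 0≤½ refl

  shrunk≤ : ∀ s {κ} → 0ℚ ≤ κ → shrunk s κ ≤ κ
  shrunk≤ zero    0≤κ = ≤-refl
  shrunk≤ (suc s) 0≤κ = ≤-trans (shrunk≤ s (*-nonNeg 0≤κ 0≤θ)) (κθ≤κ 0≤κ)

  shrunk-pos : ∀ s {κ} → 0ℚ < κ → 0ℚ < shrunk s κ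
  shrunk-pos zero    0<κ = 0<κ
  shrunk-pos (suc s) 0<κ = shrunk-pos s (*-pos 0<κ (*-pos (*-pos 0<γ 0<γ) (ladder-pos (suc (order ℕ.* order)))))

  -- Each release removes a node from `U`. The margin is stated for the full allowance of `s`
  -- releases, so it is the same if `U` is empty earlier.
  exhaust : ∀ s {B κ U F} → 1ℚ ≤ B → B ≤ b → 0ℚ ≤ κ → κ ≤ 1ℚ → ∣ U ∣ ℕ.≤ s →
    State B κ U F → StableFamily H d′ ⊎ Placeable (B - shrunk s κ)
  exhaust s {B} {κ} {U} {F} 1≤B B≤b 0≤κ κ≤1 ∣U∣≤s S with nonempty? U
  ... | no empty = inj₂ record
    { F       = F
    ; obtuse  = State.obtuse S
    ; bounded = λ u → ≤-trans (State.released S u λ u∈U → empty (u , u∈U))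
        (+-monoʳ-≤ B (neg-antimono-≤ (shrunk≤ s 0≤κ))) }
  exhaust zero {U = U} 1≤B B≤b 0≤κ κ≤1 ∣U∣≤0 S | yes (u , u∈U) =
    contradiction (ℕ.<-≤-trans (x∈p⇒∣p-x∣<∣p∣ u∈U) ∣U∣≤0) λ ()
  exhaust (suc s) {B} {κ} {U} {F} 1≤B B≤b 0≤κ κ≤1 ∣U∣≤s S | yes nonempty =
    -- The gap is chosen afresh for the current placement `F`.
    continue (uncurry (λ j → uncurry (stable-or-release 1≤B B≤b S j)) (scaleGap F) nonempty)
    where
    continue : StableFamily H d′ ⊎ (∃[ u ] u ∈ U × Releasable B U F u) →
      StableFamily H d′ ⊎ Placeable (B - shrunk (suc s) κ)
    continue (inj₁ stable)        = inj₁ stable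
    continue (inj₂ (u , u∈U , R)) = exhaust s 1≤B B≤b (*-nonNeg 0≤κ 0≤θ) (≤-trans (κθ≤κ 0≤κ) κ≤1)
      (ℕ.s≤s⁻¹ (ℕ.<-≤-trans (x∈p⇒∣p-x∣<∣p∣ u∈U) ∣U∣≤s))
      (Release.release B≤b 0≤κ κ≤1 S R)

  -- Depends only on `order` and `γ`, not on `B` or the placement, so improvements add up.
  improvement : ℚ
  improvement = shrunk order 1ℚ

  improve : ∀ {B} → 1ℚ ≤ B → B ≤ b → Placeable B → StableFamily H d′ ⊎ Placeable (B - improvement)
  improve 1≤B B≤b P = exhaust order {F = F} 1≤B B≤b (nonNegative⁻¹ 1ℚ) ≤-refl (∣p∣≤n ⊤) record
    { obtuse   = obtuse
    ; bounded  = bounded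
    ; released = λ u u∉⊤ → contradiction ∈⊤ u∉⊤ }
    where open Placeable P

-- Every placement leads to a stable family

·-scale : ∀ M p → M · p ≡ M · 1ℚ * p
·-scale zero    p = sym (*-zeroˡ p)
·-scale (suc M) p = trans (cong (p +_) (·-scale M p)) (regroup p (M · 1ℚ))
  where
  regroup : ∀ p q → p + q * p ≡ (1ℚ + q) * p
  regroup = solve-∀ ℚ-ring

·1-toℚᵘ : ∀ M → toℚᵘ (M · 1ℚ) ℚᵘ.≃ ℚᵘ.mkℚᵘ (ℤ.+ M) 0
·1-toℚᵘ zero    = ℚᵘ.≃-refl
·1-toℚᵘ (suc M) = ℚᵘ.≃-trans (toℚᵘ-homo-+ 1ℚ (M · 1ℚ))
  (ℚᵘ.≃-trans (ℚᵘ.+-congʳ ℚᵘ.1ℚᵘ (·1-toℚᵘ M)) (ℚᵘ.*≡* (cong (λ i → (ℤ.1ℤ ℤ.+ i) ℤ.* ℤ.1ℤ) (ℤ.*-identityʳ (ℤ.+ M)))))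

below-multiple : ∀ p → ∃[ M ] p ≤ M · 1ℚ
below-multiple p@(mkℚ (ℤ.+ n) d-1 _) = n , toℚᵘ-cancel-≤ (ℚᵘ.≤-respʳ-≃ (ℚᵘ.≃-sym (·1-toℚᵘ n))
  (ℚᵘ.*≤* (ℤ.*-monoˡ-≤-nonNeg (ℤ.+ n) (ℤ.+≤+ (ℕ.s≤s ℕ.z≤n)))))
below-multiple p@(mkℚ -[1+ n ] d-1 _) = 0 , <⇒≤ (negative⁻¹ p)

-- `M` is the denominator, so that `M · p` is the positive numerator.
archimedean : ∀ p → 0ℚ < p → ∃[ M ] 1ℚ ≤ M · p
archimedean p@(mkℚ (ℤ.+ suc n) d-1 _) _ = M , subst (1ℚ ≤_) (sym (·-scale M p))
  (toℚᵘ-cancel-≤ (ℚᵘ.≤-respʳ-≃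
    (ℚᵘ.≃-sym (ℚᵘ.≃-trans (toℚᵘ-homo-* (M · 1ℚ) p) (ℚᵘ.*-congʳ {toℚᵘ p} (·1-toℚᵘ M))))
    (ℚᵘ.*≤* (ℤ.+≤+ bound))))
  where
  M = suc d-1
  bound : 1 ℕ.* (1 ℕ.* suc d-1) ℕ.≤ suc d-1 ℕ.* suc n ℕ.* 1
  bound = begin
    1 ℕ.* (1 ℕ.* suc d-1)     ≡⟨ ℕ.*-identityˡ _ ⟩
    1 ℕ.* suc d-1             ≡⟨ ℕ.*-identityˡ _ ⟩
    suc d-1                   ≤⟨ ℕ.m≤m*n (suc d-1) (suc n) ⟩
    suc d-1 ℕ.* suc n         ≡⟨ ℕ.*-identityʳ _ ⟨
    suc d-1 ℕ.* suc n ℕ.* 1   ∎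
    where open ℕ.≤-Reasoning
archimedean p@(mkℚ (ℤ.+ 0) d-1 _) 0<p = contradiction (↥p≡0⇒p≡0 p refl) (≢-sym (<⇒≢ 0<p))
archimedean p@(mkℚ -[1+ n ] d-1 _) 0<p = contradiction (<-trans 0<p (negative⁻¹ p)) (<-irrefl refl)

-- Row i is (-1, …, -1, N + i, 0, …, 0), with i entries -1.
simplex : ∀ d → ℚ → Fin (suc d) → ℚ^ d
simplex (suc d) N zero    zero    = N
simplex (suc d) N zero    (suc j) = 0ℚ
simplex (suc d) N (suc i) zero    = - 1ℚ
simplex (suc d) N (suc i) (suc j) = simplex d (1ℚ + N) i j

-- For two later rows the first coordinates contribute `(-1) (-1) = 1`, which the passage from `N`
-- to `1 + N` in the recursion offsets.
simplex-obtuse : ∀ d N {i j} → i ≢ j → dot (simplex d N i) (simplex d N j) ≤ - N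
simplex-obtuse zero    N {zero}  {zero}  i≢j = contradiction refl i≢j
simplex-obtuse (suc d) N {zero}  {zero}  i≢j = contradiction refl i≢j
simplex-obtuse (suc d) N {zero}  {suc j} i≢j = ≤-reflexive (trans
  (cong (N * - 1ℚ +_) (sum-zero (λ l → 0ℚ * simplex d (1ℚ + N) j l) λ l → *-zeroˡ (simplex d (1ℚ + N) j l))) (negate N))
  where
  negate : ∀ N → N * - 1ℚ + 0ℚ ≡ - N
  negate = solve-∀ ℚ-ring
simplex-obtuse (suc d) N {suc i} {zero}  i≢j = subst (_≤ - N)
  (dot-comm (simplex (suc d) N zero) (simplex (suc d) N (suc i))) (simplex-obtuse (suc d) N {zero} {suc i} λ ())
simplex-obtuse (suc d) N {suc i} {suc j} i≢j = by-slack _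
  (slack (simplex-obtuse d (1ℚ + N) (i≢j ∘ cong suc))) (certificate N (dot (simplex d (1ℚ + N) i) (simplex d (1ℚ + N) j)))
  where
  certificate : ∀ N s → - N ≡ (- 1ℚ * - 1ℚ + s) + (- (1ℚ + N) - s)
  certificate = solve-∀ ℚ-ring

module _ (H : FiniteGraph) (r : ℕ) (edge : FiniteGraph.HasEdge H) where
  open FiniteGraph H
  open Placements H (suc r)

  private
    Stable = StableFamily H (suc r)

  iterate : ∀ {b δ} → 0ℚ ≤ δ → (∀ {B} → B ≤ b → Placeable B → Stable ⊎ Placeable (B - δ)) →
    ∀ M {B} → B ≤ b → Placeable B → Stable ⊎ Placeable (B - M · δ)
  iterate 0≤δ step zero {B} B≤b P = inj₂ (subst Placeable (drop B) P)
    where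
    drop : ∀ B → B ≡ B - 0ℚ
    drop = solve-∀ ℚ-ring
  iterate {b} {δ} 0≤δ step (suc M) {B} B≤b P = [ inj₁ , (λ P′ → [ inj₁ , inj₂ ∘ reassociate ]′
    (iterate 0≤δ step M (≤-trans B-δ≤B B≤b) P′)) ]′ (step B≤b P)
    where
    certificate : ∀ B δ → B ≡ (B - δ) + δ
    certificate = solve-∀ ℚ-ring
    B-δ≤B : B - δ ≤ B
    B-δ≤B = by-slack δ 0≤δ (certificate B δ)
    regroup : ∀ B δ s → (B - δ) - s ≡ B - (δ + s)
    regroup = solve-∀ ℚ-ring
    reassociate : Placeable ((B - δ) - M · δ) → Placeable (B - (δ + M · δ))
    reassociate = subst Placeable (regroup B δ (M · δ))

  weaken : ∀ {B B′} → B ≤ B′ → Placeable B → Placeable B′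
  weaken B≤B′ P = record { F = F ; obtuse = obtuse ; bounded = λ u → ≤-trans (bounded u) B≤B′ }
    where open Placeable P

  -- Improvements by a fixed amount would bring the bound down to 0, against `1≤bound`; so one of
  -- them must yield a stable family instead.
  placeable⇒stable : ∀ {b} → Placeable b → Stable
  placeable⇒stable {b} P = conclude (iterate (nonNegative⁻¹ 1ℚ) unit-step K ≤-refl P)
    where
    1≤b : 1ℚ ≤ b
    1≤b = 1≤bound edge P

    instance
      b-pos     = positive (<-≤-trans (positive⁻¹ 1ℚ) 1≤b)
      b-nonZero = pos⇒nonZero b

    -- The initial `b` bounds all later `B`, so this `γ` serves throughout the descent.
    γ = ⅛ * 1/ b

    0<γ : 0ℚ < γ
    0<γ = *-pos (positive⁻¹ ⅛) (positive⁻¹ (1/ b) {{1/pos⇒pos b}})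

    γb≡⅛ : γ * b ≡ ⅛
    γb≡⅛ = trans (*-assoc ⅛ (1/ b) b) (trans (cong (⅛ *_) (*-inverseˡ b)) (*-identityʳ ⅛))

    open Improvement H r b γ 1≤b 0<γ (≤-reflexive γb≡⅛)

    0<δ : 0ℚ < improvement
    0<δ = shrunk-pos order (positive⁻¹ 1ℚ)

    M = proj₁ (archimedean improvement 0<δ)
    K = proj₁ (below-multiple b)

    -- `M` improvements lower the bound by at least 1, and `K ≥ b` such rounds exhaust it.
    unit-step : ∀ {B} → B ≤ b → Placeable B → Stable ⊎ Placeable (B - 1ℚ)
    unit-step {B} B≤b P′ =
      [ inj₁ , inj₂ ∘ weaken (+-monoʳ-≤ B (neg-antimono-≤ (proj₂ (archimedean improvement 0<δ)))) ]′
      (iterate (<⇒≤ 0<δ) (λ B≤b P → improve (1≤bound edge P) B≤b P) M B≤b P′)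

    conclude : Stable ⊎ Placeable (b - K · 1ℚ) → Stable
    conclude (inj₁ stable) = stable
    conclude (inj₂ P′)     = contradiction refl (<⇒≢ (<-≤-trans (positive⁻¹ 1ℚ) (≤-trans (1≤bound edge P′) b-K≤0)))
      where
      b-K≤0 : b - K · 1ℚ ≤ 0ℚ
      b-K≤0 = subst (b - K · 1ℚ ≤_) (+-inverseʳ (K · 1ℚ)) (+-monoˡ-≤ (- (K · 1ℚ)) (proj₂ (below-multiple b)))

  colorable⇒placeable : ProperColoring (suc (suc r)) graph → ∃ Placeable
  colorable⇒placeable coloring = sum length² , record
    { F       = corner ∘ color
    ; obtuse  = λ u~v → simplex-obtuse (suc r) 1ℚ (proper u~v)
    ; bounded = λ u → term≤sum length² (λ i → ∥∥²-nonNeg (corner i)) (color u) }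
    where
    open ProperColoring coloring
    corner = simplex (suc r) 1ℚ
    length² : Fin (suc (suc r)) → ℚ
    length² i = ∥ corner i ∥²

theorem10p1 : (k : ℕ) → 2 ℕ.≤ k → (H : FiniteGraph) → FiniteGraph.HasEdge H →
    ProperColoring k (FiniteGraph.graph H) →
    LongRangeAction (𝕋 (k ℕ.∸ 1)) root (FiniteGraph.graph H)
-- With `k = r + 2`, the dimension of the placements and the branching number of the tree are both
-- `r + 1`.
theorem10p1 (suc (suc r)) _ H edge coloring = stable⇒longRange H r
  (placeable⇒stable H r edge (proj₂ (colorable⇒placeable H r edge coloring)))
theorem10p1 (suc zero) (ℕ.s≤s ()) H edge coloring
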